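{- For every integer $N\geq 1$, $\varepsilon_0(N,2)=N\cdot 4^{N-1}$.
   Context: Let $N\ge 1$. A gluing datum with $N$ edges and $2$ faces consists of a composition $(m_1,m_2)$ of $2N$ into two positive integers together with a fixed-point-free involution $\iota$ of $\{1,\dots,2N\}$. Let $\tau$ be the permutation with cycles $(1,2,\dots,m_1)$ and $(m_1+1,\dots,2N)$. The datum is connected if $\langle\iota,\tau\rangle$ acts transitively on $\{1,\dots,2N\}$, and has genus $0$ if $\tau\iota$ has exactly $N$ cycles. (Geometrically: gluings of two numbered polygons with distinguished edges, having $2N$ edges in total, into a sphere, by pairing edges and gluing paired edges with opposite orientations; equivalently rooted planar maps with $N$ edges and two numbered faces each with a marked arc.) $\varepsilon_0(N,2)$ is the number of connected genus-$0$ such data. -}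

module Defs where

open import Data.Nat using (ℕ; zero; suc; _+_; _*_; _≤_; _≤ᵇ_; _≡ᵇ_)
open import Data.Nat.DivMod using (_mod_)
open import Data.Bool using (Bool; if_then_else_)
open import Data.Fin using (Fin; toℕ)
open import Data.Vec using (Vec; lookup)
open import Data.List using (List; length; filterᵇ; map; iterate)
open import Data.Bool.ListAction using (and)
open import Data.List using () renaming (allFin to allFinL)
open import Data.Sum using (_⊎_)
open import Function using (_∘_)
open import Relation.Binary.PropositionalEquality using (_≡_; _≢_)
open import Relation.Binary.Construct.Closure.ReflexiveTransitive using (Star)

-- Labels {1,…,2N} are represented 0-based as Fin (2 * N).

-- The permutation τ with cycles (0 … m₁-1) and (m₁ … n-1), on ℕ-values.
τℕ : (n m₁ k : ℕ) → ℕ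
τℕ n m₁ k =
  if suc k ≡ᵇ m₁ then 0 else (if suc k ≡ᵇ n then m₁ else suc k)

-- τ as a map on Fin n (for m₁ < n all values of τℕ are < n, so mod is the identity).
τ : ∀ {n} → (m₁ : ℕ) → Fin n → Fin n
τ {suc n} m₁ i = τℕ (suc n) m₁ (toℕ i) mod (suc n)

-- Number of cycles of a map σ : Fin n → Fin n (intended: a permutation).
-- The cycle of i is {σ^k i | k < n}; we count the cycles by counting their
-- minimal elements.
isCycleMin : ∀ {n} → (Fin n → Fin n) → Fin n → Bool
isCycleMin {n} σ i = and (map (λ j → toℕ i ≤ᵇ toℕ j) (iterate σ i n))

numCycles : ∀ {n} → (Fin n → Fin n) → ℕ
numCycles {n} σ = length (filterᵇ (isCycleMin σ) (allFinL n))

data GenStep {n} (ι τ' : Fin n → Fin n) (i j : Fin n) : Set where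
  ι-fwd : ι i ≡ j → GenStep ι τ' i j
  ι-bwd : ι j ≡ i → GenStep ι τ' i j
  τ-fwd : τ' i ≡ j → GenStep ι τ' i j
  τ-bwd : τ' j ≡ i → GenStep ι τ' i j

Transitive⟨_,_⟩ : ∀ {n} → (Fin n → Fin n) → (Fin n → Fin n) → Set
Transitive⟨ ι , τ' ⟩ = ∀ i j → Star (GenStep ι τ') i j

-- Connected genus-0 gluing data with N edges and 2 faces.
-- Proof fields are irrelevant, so a datum is determined by (m₁, m₂, ι).
record ConnGenus0Datum (N : ℕ) : Set where
  field
    m₁ m₂    : ℕ
    .m₁-pos  : 1 ≤ m₁
    .m₂-pos  : 1 ≤ m₂
    .m-sum   : m₁ + m₂ ≡ 2 * N
    ι        : Vec (Fin (2 * N)) (2 * N)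
    .ι-invol : ∀ i → lookup ι (lookup ι i) ≡ i
    .ι-fpf   : ∀ i → lookup ι i ≢ i
    .connected : Transitive⟨ lookup ι , τ m₁ ⟩
    .genus0  : numCycles (τ m₁ ∘ lookup ι) ≡ N

{-# OPTIONS --safe #-}
module Submission where

-- If the two sides of an edge are consecutive in a face, the edge ends in a leaf of the map.
-- Removing leaves as long as possible leaves a cycle all of whose edges separate the two faces;
-- with k edges there are k ways to glue it. Orient every edge towards this cycle, and the cycle
-- itself. Each vertex then has exactly one outgoing edge, so the 2N sides of the polygons carry
-- N letters of each of two kinds. The letters show which consecutive sides form a leaf, so they
-- determine the map up to the k rotations of the cycle, and k is the excess of one letter over
-- the other in the second polygon. Hence ε₀(N,2) is the sum, over all words with N letters of each
-- kind and all positions in them, of the positive part of this excess for the suffix starting there.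
-- For words with p letters of one kind and q ≥ p of the other this sum is Σ_{i<p} (p-i)² C(p+q,i),
-- which for p = q = N equals N 4^(N-1).

open import Defs
open import Data.Bool using (Bool; true; false; not; _∧_; if_then_else_)
open import Data.Bool.ListAction using (and)
open import Data.Bool.Properties using (not-involutive; ¬-not; T-≡; ∧-zeroʳ; ∧-identityʳ)
  renaming (_≟_ to _≟ᵇ_)
open import Data.Empty using (⊥; ⊥-elim; ⊥-elim-irr)
open import Data.Fin using (Fin; zero; suc; toℕ; fromℕ<)
open import Data.Fin.Properties
  using (_≟_; toℕ-injective; toℕ-fromℕ<; toℕ<n; pigeonhole; any?; all?; +↔⊎; *↔×)
  renaming (suc-injective to Fin-suc-injective)
open import Data.List using (length; filterᵇ; iterate; map)
import Data.List as List
open import Data.Nat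
  using (ℕ; zero; suc; _+_; _*_; _∸_; _^_; _%_; _/_; _≤_; _<_; z≤n; s≤s; _≤ᵇ_; _≡ᵇ_; _≤?_)
  renaming (_≟_ to _≟ⁿ_)
open import Data.Nat.Combinatorics using (_C_; nCk+nC[k+1]≡[n+1]C[k+1]; nCk≡nC[n∸k]; nCn≡1; nC1≡n)
open import Data.Nat.DivMod using (m≡m%n+[m/n]*n; m%n<n; m<n⇒m%n≡m)
open import Data.Nat.Induction using (<-wellFounded)
open import Data.Nat.Properties using
  (*-cancelˡ-≡; *-distribˡ-+; *-zeroʳ; +-assoc; +-cancelʳ-≡; +-cancelˡ-≡; +-comm;
  +-identityʳ; +-monoʳ-≤; +-suc; 0∸n≡0; 1+n≰n; <⇒≤; m+[n∸m]≡n; m+n∸m≡n; m+n∸n≡m;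
  m<n⇒0<n∸m; m∸n+n≡m; m≤n+m; m≤n⇒m<n∨m≡n; m≤n⇒m∸n≡0; m≤n⇒m≤1+n; n<1+n; n∸n≡0; n≤1+n;
  suc-injective; ≡ᵇ⇒≡; ≡⇒≡ᵇ; ≤-antisym; ≤-refl; ≤-reflexive; ≤-total; ≤-trans; ≤ᵇ⇒≤;
  ≤⇒≤ᵇ; ≤∧≢⇒<; ≰⇒>; ≰⇒≥; <-cmp)
open import Data.Nat.Tactic.RingSolver using (solve-∀)
open import Data.Product using (Σ; ∃; _×_; _,_; proj₁; proj₂)
open import Data.Product.Function.NonDependent.Propositional using (_×-↔_)
open import Data.Sum using (_⊎_; inj₁; inj₂)
open import Data.Sum.Function.Propositional using (_⊎-↔_)
open import Data.Vec using (lookup; tabulate)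
open import Data.Vec.Properties using (lookup∘tabulate; tabulate∘lookup; tabulate-cong)
open import Function using (_∘_; id; Equivalence)
open import Function.Bundles using (_↔_; mk↔ₛ′)
open import Function.Properties.Inverse using (↔-sym; ↔-trans; ↔-refl)
open import Induction.WellFounded using (Acc; acc)
open import Relation.Binary.Construct.Closure.ReflexiveTransitive as Star
  using (Star; ε; _◅_; _◅◅_)
open import Relation.Binary.Definitions using (tri<; tri≈; tri>)
open import Relation.Binary.PropositionalEquality
open import Relation.Nullary using (Dec; yes; no; does; recompute)
open import Relation.Nullary.Decidable using (_×-dec_)

-- Genus 0 enters only through a count: one mark on each of the N cycles of `τ ∘ ι` marks exactly
-- half of the 2N sides. This balance survives the removal of a leaf, and when no leaf is left it
-- forces every remaining vertex to have exactly two half-edges; the gluing then runs around the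
-- faces in opposite directions, and one edge between the faces makes all edges cross. Connectivity
-- is needed only in the form of such an edge, which no removal of a leaf touches. Being an
-- orientation is a property of the pair of `ι` and the marks `P`. With `ι` fixed, `P` exists and is
-- unique; with `P` fixed, the gluings `ι` can be enumerated. Of the two directions around the cycle
-- the one chosen puts the letter `true` on the second face; an edge inside a face gives that face
-- both letters, so only the edges of the cycle contribute to the excess. The recursion for the sum,
-- on the first letter, leaves the region p ≤ q. Beyond the diagonal another closed form holds, and
-- the two have to agree at p = q + 1.

true≢false : ∀ {b : Bool} → b ≡ true → b ≡ false → ⊥
true≢false refl ()

-- Counting points of finite sets

bit : Bool → ℕ
bit b = if b then 1 else 0

cnt : ∀ {n} → (Fin n → Bool) → ℕ
cnt {zero}  P = 0
cnt {suc n} P = bit (P zero) + cnt (P ∘ suc)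

cnt-cong : ∀ {n} {P Q : Fin n → Bool} → P ≗ Q → cnt P ≡ cnt Q
cnt-cong {zero}  e = refl
cnt-cong {suc n} e = cong₂ _+_ (cong bit (e zero)) (cnt-cong (e ∘ suc))

length-filter-tabulate : ∀ {m n} (P : Fin m → Bool) (g : Fin n → Fin m) →
  length (filterᵇ P (List.tabulate g)) ≡ cnt (P ∘ g)
length-filter-tabulate {n = zero}  P g = refl
length-filter-tabulate {n = suc n} P g with P (g zero)
... | true  = cong suc (length-filter-tabulate P (g ∘ suc))
... | false = length-filter-tabulate P (g ∘ suc)

infixl 9 _[_≔_]
_[_≔_] : ∀ {n} {X : Set} → (Fin n → X) → Fin n → X → Fin n → X
(P [ a ≔ v ]) i = if does (i ≟ a) then v else P i

set-same : ∀ {n} {X : Set} (P : Fin n → X) a v → (P [ a ≔ v ]) a ≡ v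
set-same P a v with a ≟ a
... | yes _ = refl
... | no ne = ⊥-elim (ne refl)

set-other : ∀ {n} {X : Set} (P : Fin n → X) {a} v {i} → i ≢ a → (P [ a ≔ v ]) i ≡ P i
set-other P {a} v {i} ne with i ≟ a
... | yes e = ⊥-elim (ne e)
... | no _  = refl

cnt-remove : ∀ {n} {P Q : Fin n → Bool} a → P a ≡ true → Q a ≡ false →
  (∀ i → i ≢ a → Q i ≡ P i) → cnt P ≡ suc (cnt Q)
cnt-remove {suc n} zero Pa Qa eq rewrite Pa | Qa =
  cong suc (cnt-cong λ i → sym (eq (suc i) λ ()))
cnt-remove {suc n} {P} {Q} (suc a) Pa Qa eq =
  trans (cong₂ _+_ (cong bit (sym (eq zero λ ())))
          (cnt-remove a Pa Qa λ i ne → eq (suc i) (ne ∘ Fin-suc-injective)))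
        (+-suc (bit (Q zero)) _)

-- Induction on the source: the value at `zero` is struck out of `Q`, and by injectivity the other
-- values still land in what is left.
cnt-inj : ∀ {m n} {P : Fin m → Bool} {Q : Fin n → Bool} (g : ∀ i → P i ≡ true → Fin n) →
  (∀ i p → Q (g i p) ≡ true) → (∀ i j p q → g i p ≡ g j q → i ≡ j) → cnt P ≤ cnt Q
cnt-inj {zero} g gQ inj = z≤n
cnt-inj {suc m} {n} {P} {Q} g gQ inj with P zero in P0
... | false = cnt-inj (λ i → g (suc i)) (λ i → gQ (suc i))
                λ i j p q e → Fin-suc-injective (inj _ _ p q e)
... | true = ≤-trans
  (s≤s (cnt-inj {Q = Q [ x ≔ false ]} (λ i → g (suc i))
    (λ i p → trans (set-other Q false (λ e → case (inj _ _ p P0 e))) (gQ _ p))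
    (λ i j p q e → Fin-suc-injective (inj _ _ p q e))))
  (≤-reflexive (sym (cnt-remove x (gQ zero P0) (set-same Q x false)
    λ i ne → set-other Q false ne)))
  where
    x = g zero P0
    case : ∀ {i : Fin m} → suc i ≡ zero → ⊥
    case ()

cnt-split : ∀ {n} (P Q : Fin n → Bool) →
  cnt P ≡ cnt (λ i → P i ∧ Q i) + cnt (λ i → P i ∧ not (Q i))
cnt-split {zero} P Q = refl
cnt-split {suc n} P Q with P zero | Q zero
... | true  | true  = cong suc (cnt-split (P ∘ suc) (Q ∘ suc))
... | true  | false = trans (cong suc (cnt-split (P ∘ suc) (Q ∘ suc))) (sym (+-suc _ _))
... | false | _     = cnt-split (P ∘ suc) (Q ∘ suc)

cnt-all : ∀ n → cnt {n} (λ _ → true) ≡ n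
cnt-all zero    = refl
cnt-all (suc n) = cong suc (cnt-all n)

-- Permutations, bypassing a point, and systems of cycle representatives

Inj : ∀ {n} → (Fin n → Fin n) → Set
Inj σ = ∀ {i j} → σ i ≡ σ j → i ≡ j

Reach : ∀ {n} → (Fin n → Fin n) → Fin n → Fin n → Set
Reach σ = Star (λ i j → σ i ≡ j)

reach-cong : ∀ {n} {σ ρ : Fin n → Fin n} → σ ≗ ρ → ∀ {i j} → Reach σ i j → Reach ρ i j
reach-cong e ε = ε
reach-cong e (p ◅ r) = trans (sym (e _)) p ◅ reach-cong e r

reach-fixed : ∀ {n} {σ : Fin n → Fin n} {i j} → σ i ≡ i → Reach σ i j → j ≡ i
reach-fixed e ε = refl
reach-fixed {σ = σ} e (p ◅ r) with trans (sym p) e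
... | refl = reach-fixed {σ = σ} e r

-- The cycle through `a` closes up around it, and `a` stays behind as a fixed point, so the index
-- type never shrinks.
skip : ∀ {n} → (Fin n → Fin n) → Fin n → Fin n → Fin n
skip σ a i = if does (i ≟ a) then a else (if does (σ i ≟ a) then σ a else σ i)

module _ {n : ℕ} (σ : Fin n → Fin n) (a : Fin n) where

  skip-at : skip σ a a ≡ a
  skip-at with a ≟ a
  ... | yes _ = refl
  ... | no ne = ⊥-elim (ne refl)

  skip-hit : ∀ {i} → i ≢ a → σ i ≡ a → skip σ a i ≡ σ a
  skip-hit {i} ne e with i ≟ a | σ i ≟ a
  ... | yes e' | _ = ⊥-elim (ne e')
  ... | no _ | yes _ = refl
  ... | no _ | no ne' = ⊥-elim (ne' e)

  skip-miss : ∀ {i} → i ≢ a → σ i ≢ a → skip σ a i ≡ σ i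
  skip-miss {i} ne e with i ≟ a | σ i ≟ a
  ... | yes e' | _ = ⊥-elim (ne e')
  ... | no _ | yes e' = ⊥-elim (e e')
  ... | no _ | no _ = refl

  skip-fix : ∀ {i} → σ i ≡ i → skip σ a i ≡ i
  skip-fix {i} e with i ≟ a
  ... | yes e' = sym e'
  ... | no ne with σ i ≟ a
  ... | yes e' = ⊥-elim (ne (trans (sym e) e'))
  ... | no _ = e

  skip-inv : ∀ {X : Set} (r : Fin n → X) → (∀ i → r (σ i) ≡ r i) → ∀ i → r (skip σ a i) ≡ r i
  skip-inv r inv i with i ≟ a
  ... | yes e = cong r (sym e)
  ... | no _ with σ i ≟ a
  ... | yes e = trans (inv a) (trans (cong r (sym e)) (inv i))
  ... | no _  = inv i

  skip-reach : ∀ {i j} → Reach (skip σ a) i j → Reach σ i j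
  skip-reach ε = ε
  skip-reach {i} (p ◅ r) with i ≟ a
  ... | yes e = subst (λ z → Reach σ z _) (trans (sym p) (sym e)) (skip-reach r)
  ... | no ne with σ i ≟ a
  ... | yes e = e ◅ (p ◅ skip-reach r)
  ... | no ne' = p ◅ skip-reach r

  module _ (inj : Inj σ) where

    skip-≢ : ∀ {i} → i ≢ a → skip σ a i ≢ a
    skip-≢ {i} ne e = cases (σ i ≟ a)
      where
        cases : Dec (σ i ≡ a) → ⊥
        cases (yes p) = ne (inj (trans p (trans (sym e) (skip-hit ne p))))
        cases (no p)  = p (trans (sym (skip-miss ne p)) e)

    skip-inj : Inj (skip σ a)
    skip-inj {i} {j} e = cases (i ≟ a) (j ≟ a) (σ i ≟ a) (σ j ≟ a)
      where
        cases : Dec (i ≡ a) → Dec (j ≡ a) → Dec (σ i ≡ a) → Dec (σ j ≡ a) → i ≡ j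
        cases (yes p) (yes q) _ _ = trans p (sym q)
        cases (yes refl) (no nj) _ _ = ⊥-elim (skip-≢ nj (trans (sym e) skip-at))
        cases (no ni) (yes refl) _ _ = ⊥-elim (skip-≢ ni (trans e skip-at))
        cases _ _ (yes p) (yes q) = inj (trans p (sym q))
        cases (no ni) (no nj) (yes p) (no q) =
          ⊥-elim (nj (sym (inj (trans (sym (skip-hit ni p)) (trans e (skip-miss nj q))))))
        cases (no ni) (no nj) (no p) (yes q) =
          ⊥-elim (ni (inj (trans (sym (skip-miss ni p)) (trans e (skip-hit nj q)))))
        cases (no ni) (no nj) (no p) (no q) =
          inj (trans (sym (skip-miss ni p)) (trans e (skip-miss nj q)))

    -- Two steps through `a` become one; by injectivity the step after `a` leads away from it.
    reach-skip : ∀ {i j} → i ≢ a → j ≢ a → Reach σ i j → Reach (skip σ a) i j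
    reach-skip ni nj ε = ε
    reach-skip ni nj (_◅_ {j = k} p r) with k ≟ a
    ... | no nk = trans (skip-miss ni (λ e → nk (trans (sym p) e))) p ◅ reach-skip nk nj r
    ... | yes refl with r
    ...   | ε = ⊥-elim (nj refl)
    ...   | q ◅ r' =
      trans (skip-hit ni p) q
        ◅ reach-skip (λ e → ni (inj (trans p (sym (trans q e))))) nj r'

-- P meets every cycle of σ exactly once; rep i is the point of P on the cycle of i.
record Transversal {n} (σ : Fin n → Fin n) (P : Fin n → Bool) : Set where
  field
    rep       : Fin n → Fin n
    rep-inv   : ∀ i → rep (σ i) ≡ rep i
    rep-in    : ∀ i → P (rep i) ≡ true
    rep-id    : ∀ {i} → P i ≡ true → rep i ≡ i
    rep-reach : ∀ i → Reach σ i (rep i)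

  rep-inv* : ∀ {i j} → Reach σ i j → rep j ≡ rep i
  rep-inv* ε = refl
  rep-inv* {i} (p ◅ r) = trans (rep-inv* r) (trans (cong rep (sym p)) (rep-inv i))

  fixed⇒in : ∀ {i} → σ i ≡ i → P i ≡ true
  fixed⇒in {i} e = trans (cong P (sym (reach-fixed e (rep-reach i)))) (rep-in i)

open Transversal

transversal-cong : ∀ {n} {σ ρ : Fin n → Fin n} {P Q : Fin n → Bool} →
  σ ≗ ρ → P ≗ Q → Transversal σ P → Transversal ρ Q
transversal-cong e f T = record
  { rep       = rep T
  ; rep-inv   = λ i → trans (cong (rep T) (sym (e i))) (rep-inv T i)
  ; rep-in    = λ i → trans (sym (f _)) (rep-in T i)
  ; rep-id    = λ {i} p → rep-id T (trans (f i) p)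
  ; rep-reach = λ i → reach-cong e (rep-reach T i)
  }

-- Passing to the other representative of the same cycle is injective, because passing back undoes
-- it.
transversal-≤ : ∀ {n} {σ : Fin n → Fin n} {P Q : Fin n → Bool} →
  Transversal σ P → Transversal σ Q → cnt P ≤ cnt Q
transversal-≤ S T = cnt-inj (λ i _ → rep T i) (λ i _ → rep-in T i)
  λ i j p q e → trans (back p) (trans (cong (rep S) e) (sym (back q)))
  where
    back : ∀ {i} → _ → i ≡ rep S (rep T i)
    back {i} p = sym (trans (rep-inv* S (rep-reach T i)) (rep-id S p))

transversal-cnt : ∀ {n} {σ : Fin n → Fin n} {P Q : Fin n → Bool} →
  Transversal σ P → Transversal σ Q → cnt P ≡ cnt Q
transversal-cnt S T = ≤-antisym (transversal-≤ S T) (transversal-≤ T S)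

module _ {n : ℕ} {σ : Fin n → Fin n} (inj : Inj σ) {a : Fin n} where

  -- The old cycle keeps its mark, which is not at `a`; the new one-point cycle needs a mark of its
  -- own.
  transversal-skip : ∀ {P} → P a ≡ false → Transversal σ P →
    Transversal (skip σ a) (P [ a ≔ true ])
  transversal-skip {P} Pa T = record
    { rep = r ; rep-inv = inv ; rep-in = r-in ; rep-id = r-id ; rep-reach = reach }
    where
      r : Fin n → Fin n
      r = rep T [ a ≔ a ]

      rep≢a : ∀ i → rep T i ≢ a
      rep≢a i e = true≢false (rep-in T i) (trans (cong P e) Pa)

      r≢ : ∀ {i} → i ≢ a → r i ≡ rep T i
      r≢ = set-other (rep T) a

      inv : ∀ i → r (skip σ a i) ≡ r i
      inv i with i ≟ a
      ... | yes refl = set-same (rep T) a a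
      ... | no ni with σ i ≟ a
      ...   | yes e = trans (r≢ λ e' → ni (inj (trans e (sym e'))))
                        (trans (rep-inv T a) (trans (cong (rep T) (sym e)) (rep-inv T i)))
      ...   | no ne = trans (r≢ ne) (rep-inv T i)

      r-in : ∀ i → (P [ a ≔ true ]) (r i) ≡ true
      r-in i with i ≟ a
      ... | yes refl = set-same P a true
      ... | no ni = trans (set-other P true (rep≢a i)) (rep-in T i)

      r-id : ∀ {i} → (P [ a ≔ true ]) i ≡ true → r i ≡ i
      r-id {i} p with i ≟ a
      ... | yes refl = refl
      ... | no ni = rep-id T p

      reach : ∀ i → Reach (skip σ a) i (r i)
      reach i with i ≟ a
      ... | yes refl = ε
      ... | no ni = reach-skip σ a inj ni (rep≢a i) (rep-reach T i)

  -- When `a` rejoins the cycle of `σ a` it must give up its mark; since `σ a ≢ a`, that cycle has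
  -- one elsewhere.
  transversal-unskip : ∀ {P P'} → σ a ≢ a → P a ≡ false → (∀ {i} → i ≢ a → P i ≡ P' i) →
    Transversal (skip σ a) P' → Transversal σ P
  transversal-unskip {P} {P'} σa Pa PP' T = record
    { rep = r ; rep-inv = inv ; rep-in = r-in ; rep-id = r-id ; rep-reach = reach }
    where
      r : Fin n → Fin n
      r = rep T [ a ≔ rep T (σ a) ]

      r≢ : ∀ {i} → i ≢ a → r i ≡ rep T i
      r≢ = set-other (rep T) (rep T (σ a))

      reach-a : ∀ {i j} → i ≢ a → Reach (skip σ a) i j → j ≢ a
      reach-a ni ε = ni
      reach-a ni (p ◅ r) = reach-a (λ e → skip-≢ σ a inj ni (trans p e)) r

      rep≢a : ∀ {i} → i ≢ a → rep T i ≢ a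
      rep≢a ni = reach-a ni (rep-reach T _)

      inv : ∀ i → r (σ i) ≡ r i
      inv i = cases (i ≟ a) (σ i ≟ a)
        where
          cases : Dec (i ≡ a) → Dec (σ i ≡ a) → r (σ i) ≡ r i
          cases (yes refl) _ = trans (r≢ σa) (sym (set-same (rep T) a _))
          cases (no ni) (yes e) =
            trans (cong r e) (trans (set-same (rep T) a _)
              (trans (cong (rep T) (sym (skip-hit σ a ni e)))
                (trans (rep-inv T i) (sym (r≢ ni)))))
          cases (no ni) (no ne) =
            trans (r≢ ne) (trans (cong (rep T) (sym (skip-miss σ a ni ne)))
              (trans (rep-inv T i) (sym (r≢ ni))))

      r-in : ∀ i → P (r i) ≡ true
      r-in i with i ≟ a
      ... | yes refl = trans (PP' (rep≢a σa)) (rep-in T _)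
      ... | no ni = trans (PP' (rep≢a ni)) (rep-in T _)

      r-id : ∀ {i} → P i ≡ true → r i ≡ i
      r-id {i} p with i ≟ a
      ... | yes refl = ⊥-elim (true≢false p Pa)
      ... | no ni = rep-id T (trans (sym (PP' ni)) p)

      reach : ∀ i → Reach σ i (r i)
      reach i with i ≟ a
      ... | yes refl = refl ◅ skip-reach σ a (rep-reach T _)
      ... | no ni = skip-reach σ a (rep-reach T i)

  transversal-move : ∀ {P} → P a ≡ true → σ a ≢ a → Transversal σ P →
    Transversal σ (P [ a ≔ false ] [ σ a ≔ true ])
  transversal-move {P} Pa σa T = record
    { rep = r ; rep-inv = inv ; rep-in = r-in ; rep-id = r-id ; rep-reach = reach }
    where
      mv : Fin n → Fin n
      mv = id [ a ≔ σ a ]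

      r : Fin n → Fin n
      r i = mv (rep T i)

      inv : ∀ i → r (σ i) ≡ r i
      inv i = cong mv (rep-inv T i)

      r-in : ∀ i → (P [ a ≔ false ] [ σ a ≔ true ]) (r i) ≡ true
      r-in i with rep T i ≟ a
      ... | yes _ = set-same (P [ a ≔ false ]) (σ a) true
      ... | no ne with rep T i ≟ σ a
      ...   | yes _ = refl
      ...   | no _ = trans (set-other P false ne) (rep-in T i)

      r-id : ∀ {i} → (P [ a ≔ false ] [ σ a ≔ true ]) i ≡ true → r i ≡ i
      r-id {i} p with i ≟ σ a
      ... | yes refl = trans (cong mv (trans (rep-inv T a) (rep-id T Pa))) (set-same id a (σ a))
      ... | no _ with i ≟ a
      ...   | no ne = trans (cong mv (rep-id T p)) (set-other id (σ a) ne)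

      reach : ∀ i → Reach σ i (r i)
      reach i with rep T i ≟ a
      ... | yes e = subst (Reach σ i) e (rep-reach T i) ◅◅ (refl ◅ ε)
      ... | no _  = rep-reach T i

-- Orbits and cycle counts

iter : ∀ {n} → (Fin n → Fin n) → ℕ → Fin n → Fin n
iter σ zero    x = x
iter σ (suc k) x = σ (iter σ k x)

module _ {n : ℕ} (σ : Fin n → Fin n) where

  iter-suc : ∀ k x → iter σ k (σ x) ≡ σ (iter σ k x)
  iter-suc zero    x = refl
  iter-suc (suc k) x = cong σ (iter-suc k x)

  iter-+ : ∀ a b x → iter σ (a + b) x ≡ iter σ a (iter σ b x)
  iter-+ zero    b x = refl
  iter-+ (suc a) b x = cong σ (iter-+ a b x)

  reach-iter : ∀ k x → Reach σ x (iter σ k x)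
  reach-iter zero    x = ε
  reach-iter (suc k) x = reach-iter k x ◅◅ (refl ◅ ε)

  reach⇒iter : ∀ {x y} → Reach σ x y → ∃ λ k → iter σ k x ≡ y
  reach⇒iter ε = 0 , refl
  reach⇒iter {x} (refl ◅ r) with reach⇒iter r
  ... | k , e = suc k , trans (sym (iter-suc k x)) e

  iter-multiple : ∀ {x} p → iter σ p x ≡ x → ∀ q → iter σ (q * p) x ≡ x
  iter-multiple p e zero    = refl
  iter-multiple p e (suc q) = trans (iter-+ p (q * p) _) (trans (cong (iter σ p) (iter-multiple p e q)) e)

  iter-% : ∀ {x} p → iter σ (suc p) x ≡ x → ∀ k → iter σ (k % suc p) x ≡ iter σ k x
  iter-% {x} p e k = sym (trans (cong (λ z → iter σ z x) (m≡m%n+[m/n]*n k (suc p)))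
    (trans (iter-+ (k % suc p) _ x) (cong (iter σ (k % suc p)) (iter-multiple (suc p) e (k / suc p)))))

  module _ (inj : Inj σ) where

    iter-inj : ∀ k {x y} → iter σ k x ≡ iter σ k y → x ≡ y
    iter-inj zero    e = e
    iter-inj (suc k) e = iter-inj k (inj e)

    iter-return : ∀ {i j x} → i < j → iter σ i x ≡ iter σ j x → ∃ λ q → suc q ≤ j × iter σ (suc q) x ≡ x
    iter-return {zero} {suc j} _ e = j , ≤-refl , sym e
    iter-return {suc i} {suc j} (s≤s i<j) e with iter-return i<j (inj e)
    ... | q , le , e' = q , ≤-trans le (<⇒≤ (n<1+n j)) , e'

    periodic : ∀ x → ∃ λ q → q < n × iter σ (suc q) x ≡ x
    periodic x with pigeonhole (n<1+n n) (λ (i : Fin (suc n)) → iter σ (toℕ i) x)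
    ... | i , j , i<j , e with iter-return {i = toℕ i} i<j e
    ... | q , le , e' with toℕ<n j
    ... | s≤s j≤n = q , ≤-trans le j≤n , e'

    reach⇒iter< : ∀ {x y} → Reach σ x y → ∃ λ k → k < n × iter σ k x ≡ y
    reach⇒iter< {x} r with periodic x | reach⇒iter r
    ... | q , q<n , e | k , e' = k % suc q , ≤-trans (m%n<n k (suc q)) q<n , trans (iter-% q e k) e'

    reach-back : ∀ x → Reach σ (σ x) x
    reach-back x with periodic x
    ... | q , _ , e = subst (Reach σ (σ x)) (trans (iter-suc q x) e) (reach-iter q (σ x))

    reach-sym : ∀ {x y} → Reach σ x y → Reach σ y x
    reach-sym ε = ε
    reach-sym (refl ◅ r) = reach-sym r ◅◅ reach-back _

    -- The least period is `suc p`, not `p`, so it is positive by construction.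
    record Period (x : Fin n) (p : ℕ) : Set where
      field
        loop  : iter σ (suc p) x ≡ x
        least : ∀ {i} → i < p → iter σ (suc i) x ≢ x

    period : ∀ x → ∃ (Period x)
    period x with periodic x
    ... | q , _ , e = search q (<-wellFounded q) e
      where
        search : ∀ q → Acc _<_ q → iter σ (suc q) x ≡ x → ∃ (Period x)
        search q (acc rec) e with any? (λ (i : Fin q) → iter σ (suc (toℕ i)) x ≟ x)
        ... | yes (i , e') = search (toℕ i) (rec (toℕ<n i)) e'
        ... | no none = q , record
          { loop  = e
          ; least = λ i<q e' → none (fromℕ< i<q , trans (cong (λ z → iter σ (suc z) x) (toℕ-fromℕ< i<q)) e') }

    module _ {x : Fin n} {p : ℕ} (per : Period x p) where
      open Period per

      iter-distinct< : ∀ {i j} → i < j → j < suc p → iter σ i x ≢ iter σ j x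
      iter-distinct< {i} i<j (s≤s j≤p) e with iter-return {i = i} i<j e
      ... | q , le , e' = least (≤-trans le j≤p) e'

      iter-distinct : ∀ {i j} → i < suc p → j < suc p → iter σ i x ≡ iter σ j x → i ≡ j
      iter-distinct {i} {j} i< j< e with <-cmp i j
      ... | tri< lt _ _ = ⊥-elim (iter-distinct< lt j< e)
      ... | tri≈ _ eq _ = eq
      ... | tri> _ _ gt = ⊥-elim (iter-distinct< gt i< (sym e))

      index : ∀ {z} → Reach σ x z → ∃ λ i → i < suc p × iter σ i x ≡ z
      index r with reach⇒iter r
      ... | k , e = k % suc p , m%n<n k (suc p) , trans (iter-% p loop k) e

      orbit-cnt : ∀ {Q : Fin n → Bool} → (∀ k → Q (iter σ k x) ≡ true) →
        (∀ {z} → Q z ≡ true → Reach σ x z) → cnt Q ≡ suc p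
      orbit-cnt {Q} inQ onto = ≤-antisym
        (subst (cnt Q ≤_) (cnt-all (suc p))
          (cnt-inj {Q = λ _ → true} (λ z q → fromℕ< (proj₁ (proj₂ (index (onto q))))) (λ _ _ → refl)
            λ y z q q' e → trans (sym (proj₂ (proj₂ (index (onto q)))))
              (trans (cong (λ k → iter σ k x) (trans (sym (toℕ-fromℕ< _)) (trans (cong toℕ e) (toℕ-fromℕ< _))))
                     (proj₂ (proj₂ (index (onto q')))))))
        (subst (_≤ cnt Q) (cnt-all (suc p))
          (cnt-inj {P = λ _ → true} (λ i _ → iter σ (toℕ i) x) (λ i _ → inQ (toℕ i))
            λ i j _ _ e → toℕ-injective (iter-distinct (toℕ<n i) (toℕ<n j) e)))

    Minimal : Fin n → Set
    Minimal i = ∀ {z} → Reach σ i z → toℕ i ≤ toℕ z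

    least-in : ℕ → Fin n → Fin n
    least-in zero    i = i
    least-in (suc k) i with toℕ i ≤? toℕ (least-in k (σ i))
    ... | yes _ = i
    ... | no _  = least-in k (σ i)

    least-reach : ∀ k i → Reach σ i (least-in k i)
    least-reach zero    i = ε
    least-reach (suc k) i with toℕ i ≤? toℕ (least-in k (σ i))
    ... | yes _ = ε
    ... | no _  = refl ◅ least-reach k (σ i)

    least-≤ : ∀ k i {t} → t ≤ k → toℕ (least-in k i) ≤ toℕ (iter σ t i)
    least-≤ zero    i z≤n = ≤-refl
    least-≤ (suc k) i {t} t≤ with toℕ i ≤? toℕ (least-in k (σ i)) | t | t≤
    ... | yes le | zero  | _ = ≤-refl
    ... | yes le | suc t | s≤s t≤k = ≤-trans le (subst (λ z → _ ≤ toℕ z) (iter-suc t i) (least-≤ k (σ i) t≤k))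
    ... | no nle | zero  | _ = ≰⇒≥ nle
    ... | no nle | suc t | s≤s t≤k = subst (λ z → _ ≤ toℕ z) (iter-suc t i) (least-≤ k (σ i) t≤k)

    all-iterate : ∀ (h : Fin n → Bool) m i → and (map h (iterate σ i m)) ≡ true →
      ∀ {k} → k < m → h (iter σ k i) ≡ true
    all-iterate h (suc m) i e {k} k<m with h i in hi | k | k<m
    ... | true | zero  | _ = hi
    ... | true | suc k | s≤s k<m' = subst (λ z → h z ≡ true) (iter-suc k i) (all-iterate h m (σ i) e k<m')

    iterate-all : ∀ (h : Fin n → Bool) m i → (∀ k → h (iter σ k i) ≡ true) → and (map h (iterate σ i m)) ≡ true
    iterate-all h zero    i e = refl
    iterate-all h (suc m) i e rewrite e 0 =
      iterate-all h m (σ i) λ k → trans (cong h (iter-suc k i)) (e (suc k))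

    minimal⇒ : ∀ {i} → Minimal i → isCycleMin σ i ≡ true
    minimal⇒ {i} min = iterate-all _ n i λ k → Equivalence.to T-≡ (≤⇒≤ᵇ (min (reach-iter k i)))

    ⇒minimal : ∀ {i} → isCycleMin σ i ≡ true → Minimal i
    ⇒minimal {i} e r with reach⇒iter< r
    ... | k , k<n , refl = ≤ᵇ⇒≤ _ _ (Equivalence.from T-≡ (all-iterate _ n i e k<n))

    -- Every point of a cycle is reached in fewer than `n` steps, so the bounded test `isCycleMin`
    -- really sees the whole cycle.
    cycleMin-transversal : Transversal σ (isCycleMin σ)
    cycleMin-transversal = record
      { rep       = least-in n
      ; rep-inv   = λ i → toℕ-injective (≤-antisym
          (below (reach-back i ◅◅ least-reach n i)) (below (refl ◅ least-reach n (σ i))))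
      ; rep-in    = λ i → minimal⇒ λ r → below (least-reach n i ◅◅ r)
      ; rep-id    = λ {i} p → toℕ-injective (≤-antisym (below ε) (⇒minimal p (least-reach n i)))
      ; rep-reach = least-reach n
      }
      where
        below : ∀ {i z} → Reach σ i z → toℕ (least-in n i) ≤ toℕ z
        below {i} r with reach⇒iter< r
        ... | k , k<n , refl = least-≤ n i (<⇒≤ k<n)

    -- Frees the cycle count from the order of the labels: any set of marks will do.
    numCycles-transversal : ∀ {P} → Transversal σ P → numCycles σ ≡ cnt P
    numCycles-transversal T = trans (length-filter-tabulate (isCycleMin σ) id)
      (transversal-cnt cycleMin-transversal T)

-- Removing and gluing leaves

b≢not : ∀ {b : Bool} → b ≡ not b → ⊥
b≢not {true} ()
b≢not {false} ()

reach-closed : ∀ {n} {σ : Fin n → Fin n} (Q : Fin n → Set) → (∀ {i} → Q i → Q (σ i)) →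
  ∀ {i j} → Reach σ i j → Q i → Q j
reach-closed Q cl ε q = q
reach-closed Q cl (refl ◅ r) q = reach-closed Q cl r (cl q)

off : ∀ {n} → (Fin n → Bool) → Fin n → Fin n → Fin n → Bool
off A a b = A [ a ≔ false ] [ b ≔ false ]

module _ {n : ℕ} (A : Fin n → Bool) {a b : Fin n} where

  off-a : off A a b a ≡ false
  off-a with a ≟ b
  ... | yes _ = refl
  ... | no _  = set-same A a false

  off-b : off A a b b ≡ false
  off-b = set-same (A [ a ≔ false ]) b false

  off-other : ∀ {i} → i ≢ a → i ≢ b → off A a b i ≡ A i
  off-other na nb = trans (set-other (A [ a ≔ false ]) false nb) (set-other A false na)

  off-true : ∀ {i} → off A a b i ≡ true → A i ≡ true × i ≢ a × i ≢ b
  off-true {i} p with i ≟ b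
  ... | no nb with i ≟ a
  ...   | no na = p , na , nb

-- The involutions with and without one edge, as a relation that serves both for cutting (`ι` given)
-- and for gluing (`ι'` given).
record Glued {n} (a b : Fin n) (ι ι' : Fin n → Fin n) : Set where
  field
    ι-a   : ι a ≡ b
    ι-b   : ι b ≡ a
    ι'-a  : ι' a ≡ a
    ι'-b  : ι' b ≡ b
    other : ∀ {i} → i ≢ a → i ≢ b → ι' i ≡ ι i

open Glued

module _ {n : ℕ} {a b : Fin n} (ι : Fin n → Fin n) where

  cut-glued : ι a ≡ b → ι b ≡ a → Glued a b ι (ι [ a ≔ a ] [ b ≔ b ])
  cut-glued ιa ιb = record
    { ι-a = ιa ; ι-b = ιb ; ι'-a = at-a ; ι'-b = set-same (ι [ a ≔ a ]) b b
    ; other = λ na nb → trans (set-other (ι [ a ≔ a ]) b nb) (set-other ι a na) }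
    where
      at-a : (ι [ a ≔ a ] [ b ≔ b ]) a ≡ a
      at-a with a ≟ b
      ... | yes e = sym e
      ... | no _  = set-same ι a a

  glue-glued : a ≢ b → ι a ≡ a → ι b ≡ b → Glued a b (ι [ a ≔ b ] [ b ≔ a ]) ι
  glue-glued ne ιa ιb = record
    { ι-a = trans (set-other (ι [ a ≔ b ]) a ne) (set-same ι a b)
    ; ι-b = set-same (ι [ a ≔ b ]) b a ; ι'-a = ιa ; ι'-b = ιb
    ; other = λ na nb → sym (trans (set-other (ι [ a ≔ b ]) a nb) (set-other ι b na)) }

skip₂ : ∀ {n} → (Fin n → Fin n) → Fin n → Fin n → Fin n → Fin n
skip₂ τ a b = skip (skip τ a) b

module _ {n : ℕ} {τ : Fin n → Fin n} {a b : Fin n} {ι ι' : Fin n → Fin n}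
         (τ-inj : Inj τ) (ι-inj : Inj ι) (τa : τ a ≡ b) (a≢b : a ≢ b) (G : Glued a b ι ι') where

  -- The half-edge `b` is alone at its vertex, as `τ (ι b)` is `τ a`, that is `b`. So deleting the
  -- edge changes the vertex permutation only by taking out `a`.
  φ-skip : ∀ i → skip₂ τ a b (ι' i) ≡ skip (τ ∘ ι) a i
  φ-skip i = cases (i ≟ a) (i ≟ b)
    where
      cases : Dec (i ≡ a) → Dec (i ≡ b) → skip₂ τ a b (ι' i) ≡ skip (τ ∘ ι) a i
      cases (yes refl) _ = trans (cong (skip₂ τ a b) (ι'-a G))
        (trans (skip-fix (skip τ a) b (skip-at τ a)) (sym (skip-at (τ ∘ ι) a)))
      cases (no _) (yes refl) = trans (cong (skip₂ τ a b) (ι'-b G))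
        (trans (skip-at (skip τ a) b) (sym (skip-fix (τ ∘ ι) a (trans (cong τ (ι-b G)) τa))))
      cases (no na) (no nb) = trans (cong (skip₂ τ a b) (other G na nb)) (step (τ (ι i) ≟ a))
        where
          ιa : ι i ≢ a
          ιa e = nb (ι-inj (trans e (sym (ι-b G))))
          ιb : ι i ≢ b
          ιb e = na (ι-inj (trans e (sym (ι-a G))))
          step : Dec (τ (ι i) ≡ a) → skip₂ τ a b (ι i) ≡ skip (τ ∘ ι) a i
          step (yes e) = trans
            (skip-hit (skip τ a) b ιb (trans (skip-hit τ a ιa e) τa))
            (trans (skip-miss τ a (a≢b ∘ sym) (λ e' → ιb (τ-inj (trans e (sym e')))))
              (sym (trans (skip-hit (τ ∘ ι) a na e) (cong τ (ι-a G)))))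
          step (no ne) = trans
            (skip-miss (skip τ a) b ιb (λ e → ιa (τ-inj (trans (sym (skip-miss τ a ιa ne)) (trans e (sym τa))))))
            (trans (skip-miss τ a ιa ne) (sym (skip-miss (τ ∘ ι) a na ne)))

module _ {n : ℕ} (f : Fin n → Bool) where

  -- Removed half-edges stay in Fin n as common fixed points of τ and ι; A holds the remaining ones.
  record Faces (τ : Fin n → Fin n) (A : Fin n → Bool) : Set where
    field
      τ-inj : Inj τ
      τ-fix : ∀ {i} → A i ≡ false → τ i ≡ i
      f-τ   : ∀ i → f (τ i) ≡ f i
      orbit : ∀ {i j} → A i ≡ true → A j ≡ true → f i ≡ f j → Reach τ i j

    A-τ : ∀ {i} → A i ≡ true → A (τ i) ≡ true
    A-τ {i} p with A (τ i) in e
    ... | true  = refl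
    ... | false = trans (sym e) (trans (cong A (τ-inj (τ-fix e))) p)

  -- Each face is a single orbit of `τ`, so `crossing` amounts to connectivity; unlike transitivity
  -- it is not affected by inactive half-edges.
  record Gluing (τ : Fin n → Fin n) (A : Fin n → Bool) (ι : Fin n → Fin n) : Set where
    field
      faces    : Faces τ A
      ι-invol  : ∀ i → ι (ι i) ≡ i
      ι-fix    : ∀ {i} → A i ≡ false → ι i ≡ i
      ι-act    : ∀ {i} → A i ≡ true → ι i ≢ i
      crossing : ∃ λ x → f x ≡ false × f (ι x) ≡ true

    open Faces faces public

    ι-inj : Inj ι
    ι-inj e = trans (sym (ι-invol _)) (trans (cong ι e) (ι-invol _))

    φ-inj : Inj (τ ∘ ι)
    φ-inj e = ι-inj (τ-inj e)

    A-ι : ∀ {i} → A i ≡ true → A (ι i) ≡ true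
    A-ι {i} p with A (ι i) in e
    ... | true  = refl
    ... | false = ⊥-elim (ι-act p (ι-inj (ι-fix e)))

    crossing-at : ∀ c → ∃ λ x → A x ≡ true × f x ≡ c × f (ι x) ≡ not c
    crossing-at c with crossing
    ... | x , p , q with A x in e
    ...   | false = ⊥-elim (true≢false q (trans (cong f (ι-fix e)) p))
    ...   | true with c
    ...     | false = x , e , p , q
    ...     | true  = ι x , A-ι e , q , trans (cong f (ι-invol x)) p

  -- P marks one half-edge at every vertex: that of the edge by which one moves towards the cycle
  -- of the map or, at a vertex of the cycle, around it.
  record Oriented (τ : Fin n → Fin n) (A : Fin n → Bool) (ι : Fin n → Fin n) (P : Fin n → Bool) : Set where
    field
      gluing      : Gluing τ A ι
      transversal : Transversal (τ ∘ ι) P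
      flip        : ∀ {i} → A i ≡ true → P (ι i) ≡ not (P i)
      cross       : ∀ {i} → f (ι i) ≡ not (f i) → P i ≡ f i

    open Gluing gluing public

    inactive-in : ∀ {i} → A i ≡ false → P i ≡ true
    inactive-in {i} e = fixed⇒in transversal (trans (cong τ (ι-fix e)) (τ-fix e))

  open Faces
  open Gluing using (faces; ι-invol; ι-fix; ι-act; crossing; ι-inj; φ-inj; A-ι; crossing-at)
  open Oriented using (gluing; transversal; flip; cross; inactive-in)

  module _ {τ : Fin n → Fin n} {A : Fin n → Bool} (F : Faces τ A) (a b : Fin n) where

    faces-skip₂ : Faces (skip₂ τ a b) (off A a b)
    faces-skip₂ = record
      { τ-inj = skip-inj (skip τ a) b (skip-inj τ a (τ-inj F))
      ; τ-fix = fix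
      ; f-τ   = skip-inv (skip τ a) b f (skip-inv τ a f (f-τ F))
      ; orbit = orb
      }
      where
        fix : ∀ {i} → off A a b i ≡ false → skip₂ τ a b i ≡ i
        fix {i} p = cases (i ≟ a) (i ≟ b)
          where
            cases : Dec (i ≡ a) → Dec (i ≡ b) → skip₂ τ a b i ≡ i
            cases _ (yes refl) = skip-at (skip τ a) b
            cases (yes refl) _ = skip-fix (skip τ a) b (skip-at τ a)
            cases (no na) (no nb) =
              skip-fix (skip τ a) b (skip-fix τ a (τ-fix F (trans (sym (off-other A na nb)) p)))

        orb : ∀ {i j} → off A a b i ≡ true → off A a b j ≡ true → f i ≡ f j → Reach (skip₂ τ a b) i j
        orb p q e with off-true A p | off-true A q
        ... | Ai , ia , ib | Aj , ja , jb =
          reach-skip (skip τ a) b (skip-inj τ a (τ-inj F)) ib jb (reach-skip τ a (τ-inj F) ia ja (orbit F Ai Aj e))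

  module _ {τ : Fin n → Fin n} {A : Fin n → Bool} {a b : Fin n} {ι ι' : Fin n → Fin n}
           (Aa : A a ≡ true) (Ab : A b ≡ true) (G : Glued a b ι ι') where

    -- Both sides of the deleted edge lie in one face, so the crossing edge is another one and
    -- survives.
    gluing-cut : f a ≡ f b → Gluing τ A ι → Gluing (skip₂ τ a b) (off A a b) ι'
    gluing-cut fab M = record
      { faces = faces-skip₂ (faces M) a b
      ; ι-invol = invol
      ; ι-fix = fix
      ; ι-act = λ p e → case-act (off-true A p) e
      ; crossing = cr
      }
      where
        invol : ∀ i → ι' (ι' i) ≡ i
        invol i = cases (i ≟ a) (i ≟ b)
          where
            cases : Dec (i ≡ a) → Dec (i ≡ b) → ι' (ι' i) ≡ i
            cases (yes refl) _ = trans (cong ι' (ι'-a G)) (ι'-a G)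
            cases _ (yes refl) = trans (cong ι' (ι'-b G)) (ι'-b G)
            cases (no na) (no nb) = trans (cong ι' (other G na nb)) (trans
              (other G (λ e → nb (ι-inj M (trans e (sym (ι-b G))))) (λ e → na (ι-inj M (trans e (sym (ι-a G))))))
              (ι-invol M i))

        fix : ∀ {i} → off A a b i ≡ false → ι' i ≡ i
        fix {i} p = cases (i ≟ a) (i ≟ b)
          where
            cases : Dec (i ≡ a) → Dec (i ≡ b) → ι' i ≡ i
            cases (yes refl) _ = ι'-a G
            cases _ (yes refl) = ι'-b G
            cases (no na) (no nb) = trans (other G na nb) (ι-fix M (trans (sym (off-other A na nb)) p))

        case-act : ∀ {i} → A i ≡ true × i ≢ a × i ≢ b → ι' i ≢ i
        case-act (p , na , nb) e = ι-act M p (trans (sym (other G na nb)) e)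

        cr : ∃ λ x → f x ≡ false × f (ι' x) ≡ true
        cr with crossing M
        ... | x , p , q = x , p , trans (cong f (other G
                (λ { refl → true≢false q (trans (cong f (ι-a G)) (trans (sym fab) p)) })
                (λ { refl → true≢false q (trans (cong f (ι-b G)) (trans fab p)) }))) q

    gluing-glue : a ≢ b → Faces τ A → Gluing (skip₂ τ a b) (off A a b) ι' → Gluing τ A ι
    gluing-glue a≢b F M = record
      { faces = F ; ι-invol = invol ; ι-fix = fix ; ι-act = act ; crossing = cr }
      where
        invol : ∀ i → ι (ι i) ≡ i
        invol i = cases (i ≟ a) (i ≟ b)
          where
            cases : Dec (i ≡ a) → Dec (i ≡ b) → ι (ι i) ≡ i
            cases (yes refl) _ = trans (cong ι (ι-a G)) (ι-b G)
            cases _ (yes refl) = trans (cong ι (ι-b G)) (ι-a G)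
            cases (no na) (no nb) = trans (cong ι (sym (other G na nb))) (trans
              (sym (other G (λ e → na (ι-inj M (trans e (sym (ι'-a G))))) (λ e → nb (ι-inj M (trans e (sym (ι'-b G)))))))
              (ι-invol M i))

        fix : ∀ {i} → A i ≡ false → ι i ≡ i
        fix p = trans (sym (other G na nb)) (ι-fix M (trans (off-other A na nb) p))
          where
            na : _ ≢ a
            na refl = true≢false Aa p
            nb : _ ≢ b
            nb refl = true≢false Ab p

        act : ∀ {i} → A i ≡ true → ι i ≢ i
        act {i} p e = cases (i ≟ a) (i ≟ b)
          where
            cases : Dec (i ≡ a) → Dec (i ≡ b) → ⊥
            cases (yes refl) _ = a≢b (trans (sym e) (ι-a G))
            cases _ (yes refl) = a≢b (trans (sym (ι-b G)) e)
            cases (no na) (no nb) = ι-act M (trans (off-other A na nb) p) (trans (other G na nb) e)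

        cr : ∃ λ x → f x ≡ false × f (ι x) ≡ true
        cr with crossing M
        ... | x , p , q = x , p , trans (cong f (sym (other G
                (λ { refl → true≢false q (trans (cong f (ι'-a G)) p) })
                (λ { refl → true≢false q (trans (cong f (ι'-b G)) p) })))) q

  module _ {τ : Fin n → Fin n} {A : Fin n → Bool} {a b : Fin n} {ι : Fin n → Fin n}
           (M : Gluing τ A ι) (Aa : A a ≡ true) (τa : τ a ≡ b) where

    f-ab : f a ≡ f b
    f-ab = trans (sym (f-τ (faces M) a)) (cong f τa)

    -- Otherwise `a` and `b`, glued to each other, would make up a whole face, and no edge would
    -- leave it.
    not-2-cycle : ι a ≡ b → τ b ≢ a
    not-2-cycle ιa τb with crossing-at M (f a)
    ... | x , Ax , fx , fιx with reach-closed (λ i → i ≡ a ⊎ i ≡ b)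
            (λ { (inj₁ refl) → inj₂ τa ; (inj₂ refl) → inj₁ τb })
            (orbit (faces M) Aa Ax (sym fx)) (inj₁ refl)
    ...   | inj₁ refl = b≢not (trans f-ab (trans (cong f (sym ιa)) fιx))
    ...   | inj₂ refl = b≢not (trans (cong f (trans (sym (ι-invol M a)) (cong ι ιa))) fιx)

  module _ {τ : Fin n → Fin n} {A : Fin n → Bool} {a b : Fin n} {ι ι' : Fin n → Fin n} {P : Fin n → Bool}
           (Aa : A a ≡ true) (Ab : A b ≡ true) (τa : τ a ≡ b) (a≢b : a ≢ b) (G : Glued a b ι ι') where

    leaf-in : Oriented τ A ι P → P b ≡ true
    leaf-in O = fixed⇒in (transversal O) (trans (cong τ (ι-b G)) τa)

    leaf-out : Oriented τ A ι P → P a ≡ false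
    leaf-out O = trans (cong P (sym (ι-b G))) (trans (flip O Ab) (cong not (leaf-in O)))

    oriented-cut : Oriented τ A ι P → Oriented (skip₂ τ a b) (off A a b) ι' (P [ a ≔ true ])
    oriented-cut O = record
      { gluing      = gluing-cut Aa Ab G (f-ab M Aa τa) M
      ; transversal = transversal-cong (λ i → sym (φ-skip (τ-inj (faces M)) (ι-inj M) τa a≢b G i)) (λ _ → refl)
          (transversal-skip (φ-inj M) (leaf-out O) (transversal O))
      ; flip  = λ p → flip' (off-true A p)
      ; cross = λ {i} e → trans (set-other P true λ { refl → b≢not (trans (cong f (sym (ι'-a G))) e) })
          (cross O (trans (cong f (sym (other G
            (λ { refl → b≢not (trans (cong f (sym (ι'-a G))) e) })
            (λ { refl → b≢not (trans (cong f (sym (ι'-b G))) e) })))) e))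
      }
      where
        M = gluing O
        flip' : ∀ {i} → A i ≡ true × i ≢ a × i ≢ b → (P [ a ≔ true ]) (ι' i) ≡ not ((P [ a ≔ true ]) i)
        flip' {i} (Ai , na , nb) = trans (cong (P [ a ≔ true ]) (other G na nb)) (trans
          (set-other P true (λ e → nb (ι-inj M (trans e (sym (ι-b G))))))
          (trans (flip O Ai) (cong not (sym (set-other P true na)))))

    oriented-glue : ∀ {P'} → Faces τ A → P a ≡ false → P b ≡ true → (∀ {i} → i ≢ a → P i ≡ P' i) →
      Oriented (skip₂ τ a b) (off A a b) ι' P' → Oriented τ A ι P
    oriented-glue {P'} F Pa Pb PP' O = record
      { gluing      = M
      ; transversal = transversal-unskip (φ-inj M)
          -- The half-edge `a` is not alone at its vertex, for then `τ b` would be `a`.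
          (λ e → not-2-cycle M Aa τa (ι-a G) (trans (cong τ (sym (ι-a G))) e)) Pa PP'
          (transversal-cong (φ-skip (τ-inj F) (ι-inj M) τa a≢b G) (λ _ → refl) (transversal O))
      ; flip  = flip'
      ; cross = cross'
      }
      where
        M : Gluing τ A ι
        M = gluing-glue Aa Ab G a≢b F (gluing O)

        flip' : ∀ {i} → A i ≡ true → P (ι i) ≡ not (P i)
        flip' {i} p = cases (i ≟ a) (i ≟ b)
          where
            cases : Dec (i ≡ a) → Dec (i ≡ b) → P (ι i) ≡ not (P i)
            cases (yes refl) _ = trans (cong P (ι-a G)) (trans Pb (cong not (sym Pa)))
            cases _ (yes refl) = trans (cong P (ι-b G)) (trans Pa (cong not (sym Pb)))
            cases (no na) (no nb) = trans
              (PP' (λ e → nb (ι-inj M (trans e (sym (ι-b G))))))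
              (trans (cong P' (sym (other G na nb)))
                (trans (flip O (trans (off-other A na nb) p)) (cong not (sym (PP' na)))))

        cross' : ∀ {i} → f (ι i) ≡ not (f i) → P i ≡ f i
        cross' {i} e = cases (i ≟ a) (i ≟ b)
          where
            cases : Dec (i ≡ a) → Dec (i ≡ b) → P i ≡ f i
            cases (yes refl) _ = ⊥-elim (b≢not (trans (f-ab M Aa τa) (trans (cong f (sym (ι-a G))) e)))
            cases _ (yes refl) = ⊥-elim (b≢not (trans (sym (f-ab M Aa τa)) (trans (cong f (sym (ι-b G))) e)))
            cases (no na) (no nb) = trans (PP' na) (cross O (trans (cong f (other G na nb)) e))

-- Existence and uniqueness of the orientation

open Faces
open Gluing using (faces; ι-invol; ι-fix; ι-act; crossing; ι-inj; φ-inj; A-ι; crossing-at)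
open Oriented using (gluing; transversal; flip; cross; inactive-in)

-- With A everywhere true this says that P has as many points as its complement; it is stated
-- so that removing a leaf raises both sides by exactly one.
Balanced : ∀ {n} → (Fin n → Bool) → (Fin n → Bool) → Set
Balanced A P = cnt P ≡ cnt (λ i → not (P i ∧ A i))

cnt-off : ∀ {n} (A : Fin n → Bool) {a b} → a ≢ b → A a ≡ true → A b ≡ true → cnt (off A a b) < cnt A
cnt-off A {a} {b} ne Aa Ab = ≤-trans
  (≤-reflexive (sym (cnt-remove b (trans (set-other A false (ne ∘ sym)) Ab) (off-b A {a} {b})
    λ i ni → set-other (A [ a ≔ false ]) false ni)))
  (≤-trans (n≤1+n _) (≤-reflexive (sym (cnt-remove a Aa (set-same A a false) λ i ni → set-other A false ni))))

balanced-cut : ∀ {n} {A P : Fin n → Bool} {a b} → P a ≡ false → P b ≡ true → A b ≡ true →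
  Balanced A P → Balanced (off A a b) (P [ a ≔ true ])
balanced-cut {A = A} {P} {a} {b} Pa Pb Ab bal = trans
  (cnt-remove a (set-same P a true) Pa λ i ni → sym (set-other P true ni))
  (trans (cong suc bal) (sym (cnt-remove b
    (cong not (trans (cong ((P [ a ≔ true ]) b ∧_) (off-b A {a} {b})) (∧-zeroʳ _)))
    (cong not (cong₂ _∧_ Pb Ab)) same)))
  where
    same : ∀ i → i ≢ b → not (P i ∧ A i) ≡ not ((P [ a ≔ true ]) i ∧ off A a b i)
    same i nb = cases (i ≟ a)
      where
        cases : Dec (i ≡ a) → not (P i ∧ A i) ≡ not ((P [ a ≔ true ]) i ∧ off A a b i)
        cases (yes refl) = trans (cong (λ x → not (x ∧ A a)) Pa)
          (cong not (sym (trans (cong ((P [ a ≔ true ]) a ∧_) (off-a A {a} {b})) (∧-zeroʳ _))))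
        cases (no na) = cong not (cong₂ _∧_ (sym (set-other P true na)) (sym (off-other A na nb)))

balanced-move : ∀ {n} {A P : Fin n → Bool} {a c} → P a ≡ true → P c ≡ false → A a ≡ true → A c ≡ true →
  cnt (λ i → not (P i ∧ A i)) ≡ cnt (λ i → not ((P [ a ≔ false ] [ c ≔ true ]) i ∧ A i))
balanced-move {A = A} {P} {a} {c} Pa Pc Aa Ac = trans
  (cnt-remove c (cong (λ x → not (x ∧ A c)) Pc) (set-same U c false) λ i ni → set-other U false ni)
  (sym (cnt-remove a (cong (λ x → not (x ∧ A a)) (trans (set-other (P [ a ≔ false ]) true a≢c) (set-same P a false)))
    (trans (set-other U false a≢c) (cong not (cong₂ _∧_ Pa Aa))) same))
  where
    U : Fin _ → Bool
    U i = not (P i ∧ A i)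
    a≢c : a ≢ c
    a≢c refl = true≢false Pa Pc
    same : ∀ i → i ≢ a → (U [ c ≔ false ]) i ≡ not ((P [ a ≔ false ] [ c ≔ true ]) i ∧ A i)
    same i na = cases (i ≟ c)
      where
        cases : Dec (i ≡ c) → (U [ c ≔ false ]) i ≡ not ((P [ a ≔ false ] [ c ≔ true ]) i ∧ A i)
        cases (yes refl) = trans (set-same U c false)
          (sym (cong not (cong₂ _∧_ (set-same (P [ a ≔ false ]) c true) Ac)))
        cases (no nc) = trans (set-other U false nc)
          (cong (λ x → not (x ∧ A i)) (sym (trans (set-other (P [ a ≔ false ]) true nc) (set-other P false na))))

module _ {n : ℕ} (f : Fin n → Bool) where

  -- A dismantling, leaf by leaf, down to the cycle. It does not mention marks, so existence and
  -- uniqueness of the orientation are both inductions on it.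
  data Reducible (τ : Fin n → Fin n) (A : Fin n → Bool) (ι : Fin n → Fin n) : Set where
    core : Gluing f τ A ι → (∀ i → τ (ι (τ (ι i))) ≡ i) →
      (∀ {i} → A i ≡ true → f (ι i) ≡ not (f i)) → Reducible τ A ι
    leaf : ∀ {a b ι'} → Gluing f τ A ι → A a ≡ true → A b ≡ true → τ a ≡ b → a ≢ b →
      Glued a b ι ι' → Reducible (skip₂ τ a b) (off A a b) ι' → Reducible τ A ι

  module _ {τ : Fin n → Fin n} {A : Fin n → Bool} {ι : Fin n → Fin n} (M : Gluing f τ A ι) where

    -- The hypothesis makes a step forward on one side of an edge a step back on the other, so
    -- crossing passes from each side to the next in its face; a crossing edge starts this in either
    -- face.
    all-cross : (∀ i → τ (ι (τ (ι i))) ≡ i) → ∀ {i} → A i ≡ true → f (ι i) ≡ not (f i)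
    all-cross φφ {i} Ai with crossing-at M (f i)
    ... | x , Ax , fx , fιx = reach-closed (λ z → f (ι z) ≡ not (f z)) step
            (orbit (faces M) Ax Ai fx) (trans fιx (cong not (sym fx)))
      where
        step : ∀ {z} → f (ι z) ≡ not (f z) → f (ι (τ z)) ≡ not (f (τ z))
        step {z} e = begin
          f (ι (τ z))              ≡⟨ f-τ (faces M) _ ⟨
          f (τ (ι (τ z)))          ≡⟨ cong (f ∘ τ ∘ ι ∘ τ) (ι-invol M z) ⟨
          f (τ (ι (τ (ι (ι z)))))  ≡⟨ cong f (φφ (ι z)) ⟩
          f (ι z)                  ≡⟨ e ⟩
          not (f z)                ≡⟨ cong not (f-τ (faces M) z) ⟨
          not (f (τ z))            ∎
          where open ≡-Reasoning

    module _ {P : Fin n → Bool} (T : Transversal (τ ∘ ι) P) (bal : Balanced A P)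
             (no-leaf : ∀ {b} → A b ≡ true → τ (ι b) ≢ b) where

      private
        φ : Fin n → Fin n
        φ i = τ (ι i)

        φ-fix : ∀ {i} → A i ≡ false → φ i ≡ i
        φ-fix e = trans (cong τ (ι-fix M e)) (τ-fix (faces M) e)

        φ-out : ∀ {p} → A p ≡ true → P p ≡ true → P (φ p) ≡ false
        φ-out {p} Ap Pp with P (φ p) in e
        ... | false = refl
        ... | true  = ⊥-elim (no-leaf Ap
                (trans (sym (rep-id T e)) (trans (rep-inv T p) (rep-id T Pp))))

        -- Otherwise φ would inject P into the complement of P ∧ A minus the point φ i.
        φ-in : ∀ {i} → P i ≡ false → P (φ i) ≡ true
        φ-in {i} Pi with P (φ i) in e
        ... | true  = refl
        ... | false = ⊥-elim (1+n≰n (≤-trans (≤-reflexive (trans (sym U≡) (sym bal))) P≤))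
          where
            U : Fin n → Bool
            U j = not (P j ∧ A j)

            U≡ : cnt U ≡ suc (cnt (U [ φ i ≔ false ]))
            U≡ = cnt-remove (φ i) (cong (λ x → not (x ∧ A (φ i))) e) (set-same U (φ i) false)
                   λ j nj → set-other U false nj

            lands : ∀ p → P p ≡ true → U (φ p) ≡ true
            lands p Pp with A p in Ap
            ... | true  = cong (λ x → not (x ∧ A (φ p))) (φ-out Ap Pp)
            ... | false = cong not (trans (cong (P (φ p) ∧_) (trans (cong A (φ-fix Ap)) Ap)) (∧-zeroʳ _))

            P≤ : cnt P ≤ cnt (U [ φ i ≔ false ])
            P≤ = cnt-inj (λ p _ → φ p)
              (λ p Pp → trans (set-other U false λ e' → true≢false Pp (trans (cong P (φ-inj M e')) Pi)) (lands p Pp))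
              λ _ _ _ _ → φ-inj M

        φφ-in : ∀ {p} → A p ≡ true → P p ≡ true → φ (φ p) ≡ p
        φφ-in {p} Ap Pp = trans (sym (rep-id T (φ-in (φ-out Ap Pp))))
          (trans (rep-inv T (φ p)) (trans (rep-inv T p) (rep-id T Pp)))

      -- Balance says that active cycles have two points on average, and none has just one.
      -- Concretely `φ` sends marked active points to unmarked ones and, by balance, unmarked points
      -- to marked ones; a marked point returns after two steps since its cycle has only one mark.
      no-leaf⇒φφ : ∀ i → τ (ι (τ (ι i))) ≡ i
      no-leaf⇒φφ i with A i in Ai
      ... | false = trans (cong φ (φ-fix Ai)) (φ-fix Ai)
      ... | true with P i in Pi
      ...   | true  = φφ-in Ai Pi
      ...   | false = φ-inj M (φφ-in (A-τ (faces M) (A-ι M Ai)) (φ-in Pi))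

  -- The marks `P` need not be an orientation here; they only express the balance and may be moved
  -- along a cycle when they are in the way.
  reduce : ∀ {τ A ι P} → Acc _<_ (cnt A) → Gluing f τ A ι → Transversal (τ ∘ ι) P →
    Balanced A P → Reducible τ A ι
  reduce {τ} {A} {ι} {P} (acc rec) M T bal
    with any? (λ b → A b ≟ᵇ true ×-dec τ (ι b) ≟ b)
  ... | no none = core M φφ (all-cross M φφ)
    where φφ = no-leaf⇒φφ M T bal λ Ab e → none (_ , Ab , e)
  ... | yes (b , Ab , e) = cases (P (ι b)) refl
    where
      a = ι b
      Aa = A-ι M Ab
      a≢b : a ≢ b
      a≢b = ι-act M Ab
      G = cut-glued ι (ι-invol M b) refl
      Pb : ∀ {Q} → Transversal (τ ∘ ι) Q → Q b ≡ true
      Pb S = fixed⇒in S e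

      φa≢a : τ (ι a) ≢ a
      φa≢a e' = not-2-cycle f M Aa e (ι-invol M b) (trans (cong τ (sym (ι-invol M b))) e')

      rest : ∀ {Q} → Q a ≡ false → Transversal (τ ∘ ι) Q → Balanced A Q → Reducible τ A ι
      rest {Q} Qa S bal = leaf M Aa Ab e a≢b G
        (reduce (rec (cnt-off A a≢b Aa Ab)) (gluing-cut f Aa Ab G (f-ab f M Aa e) M)
          (transversal-cong (λ i → sym (φ-skip (τ-inj (faces M)) (ι-inj M) e a≢b G i)) (λ _ → refl)
            (transversal-skip (φ-inj M) Qa S))
          (balanced-cut {A = A} {Q} Qa (Pb S) Ab bal))

      cases : ∀ v → P a ≡ v → Reducible τ A ι
      cases false Pa = rest Pa T bal
      -- The mark sits on the half-edge to be cut out, so it first moves to the next half-edge at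
      -- the same vertex, which is a different one by `φa≢a`.
      cases true  Pa = rest P₁a T₁ (trans (sym (transversal-cnt T T₁))
        (trans bal (balanced-move {A = A} Pa φa-out Aa (A-τ (faces M) (A-ι M Aa)))))
        where
          φa-out : P (τ (ι a)) ≡ false
          φa-out with P (τ (ι a)) in e'
          ... | false = refl
          ... | true  = ⊥-elim (φa≢a (trans (sym (rep-id T e')) (trans (rep-inv T a) (rep-id T Pa))))

          P₁ = P [ a ≔ false ] [ τ (ι a) ≔ true ]
          T₁ : Transversal (τ ∘ ι) P₁
          T₁ = transversal-move (φ-inj M) Pa φa≢a T
          P₁a : P₁ a ≡ false
          P₁a = trans (set-other (P [ a ≔ false ]) true (φa≢a ∘ sym)) (set-same P a false)

  -- A vertex of the cycle has two half-edges, one in each face; marking all those of the second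
  -- face marks each vertex once.
  core-oriented : ∀ {τ A ι P} → Gluing f τ A ι → (∀ i → τ (ι (τ (ι i))) ≡ i) →
    (∀ {i} → A i ≡ true → f (ι i) ≡ not (f i)) →
    (∀ {i} → A i ≡ true → P i ≡ f i) → (∀ {i} → A i ≡ false → P i ≡ true) → Oriented f τ A ι P
  core-oriented {τ} {A} {ι} {P} M φφ cr act inact = record
    { gluing      = M
    ; transversal = record
      { rep = r ; rep-inv = inv ; rep-in = r-in ; rep-id = r-id ; rep-reach = reach }
    ; flip        = λ p → trans (act (A-ι M p)) (trans (cr p) (cong not (sym (act p))))
    ; cross       = cross'
    }
    where
      r : Fin n → Fin n
      r i = if P i then i else τ (ι i)

      φ-flip : ∀ {i} → A i ≡ true → P (τ (ι i)) ≡ not (P i)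
      φ-flip Ai = trans (act (A-τ (faces M) (A-ι M Ai)))
        (trans (f-τ (faces M) _) (trans (cr Ai) (cong not (sym (act Ai)))))

      inv : ∀ i → r (τ (ι i)) ≡ r i
      inv i with A i in Ai
      ... | false = cong r (trans (cong τ (ι-fix M Ai)) (τ-fix (faces M) Ai))
      ... | true rewrite φ-flip Ai with P i
      ...   | true  = φφ i
      ...   | false = refl

      out-active : ∀ {i} → P i ≡ false → A i ≡ true
      out-active {i} e with A i in Ai
      ... | true  = refl
      ... | false = ⊥-elim (true≢false (inact Ai) e)

      r-in : ∀ i → P (r i) ≡ true
      r-in i with P i in Pi
      ... | true  = Pi
      ... | false = trans (φ-flip (out-active Pi)) (cong not Pi)

      r-id : ∀ {i} → P i ≡ true → r i ≡ i
      r-id p rewrite p = refl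

      reach : ∀ i → Reach (τ ∘ ι) i (r i)
      reach i with P i
      ... | true  = ε
      ... | false = refl ◅ ε

      cross' : ∀ {i} → f (ι i) ≡ not (f i) → P i ≡ f i
      cross' {i} e with A i in Ai
      ... | true  = act Ai
      ... | false = ⊥-elim (b≢not (trans (cong f (sym (ι-fix M Ai))) e))

  reducible⇒oriented : ∀ {τ A ι} → Reducible τ A ι → ∃ (Oriented f τ A ι)
  reducible⇒oriented {A = A} (core M φφ cr) = P , core-oriented M φφ cr act inact
    where
      P : Fin n → Bool
      P i = if A i then f i else true
      act : ∀ {i} → A i ≡ true → P i ≡ f i
      act p rewrite p = refl
      inact : ∀ {i} → A i ≡ false → P i ≡ true
      inact p rewrite p = refl
  reducible⇒oriented {A = A} (leaf {a} {b} M Aa Ab τa a≢b G R) with reducible⇒oriented R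
  ... | P , O = P [ a ≔ false ] , oriented-glue f Aa Ab τa a≢b G (faces M) (set-same P a false)
          (trans (set-other P false (a≢b ∘ sym)) (inactive-in O (off-b A {a} {b})))
          (set-other P false) O

  -- Nothing is left to choose: `cross` decides on the cycle, and a leaf vertex has only one
  -- half-edge to mark.
  oriented-unique : ∀ {τ A ι P Q} → Reducible τ A ι → Oriented f τ A ι P → Oriented f τ A ι Q → P ≗ Q
  oriented-unique {A = A} (core M φφ cr) O O' i with A i in Ai
  ... | true  = trans (cross O (cr Ai)) (sym (cross O' (cr Ai)))
  ... | false = trans (inactive-in O Ai) (sym (inactive-in O' Ai))
  oriented-unique {P = P} {Q} (leaf {a} {b} M Aa Ab τa a≢b G R) O O' i = cases (i ≟ a)
    where
      cut : ∀ {P} → Oriented f _ _ _ P → Oriented f _ _ _ (P [ a ≔ true ])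
      cut = oriented-cut f Aa Ab τa a≢b G
      cases : Dec (i ≡ a) → P i ≡ Q i
      cases (yes refl) = trans (leaf-out f Aa Ab τa a≢b G O) (sym (leaf-out f Aa Ab τa a≢b G O'))
      cases (no na) = trans (sym (set-other P true na))
        (trans (oriented-unique R (cut O) (cut O') i) (set-other Q true na))

  -- On the cycle the marks are constant along each face, so the pattern cannot occur there. If
  -- another leaf `a`, `b` is removed, then `c` is not `b` and `τ c` is not `a`, by their marks;
  -- hence `c` and `τ c` remain neighbours and the pattern survives.
  pattern-leaf : ∀ {τ A ι P c} → Reducible τ A ι → Oriented f τ A ι P → A c ≡ true →
    P c ≡ false → P (τ c) ≡ true → ι c ≡ τ c
  pattern-leaf (core M φφ cr) O Ac Pc Pτc = ⊥-elim (true≢false Pτc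
    (trans (cross O (cr (A-τ (faces M) Ac))) (trans (f-τ (faces M) _) (trans (sym (cross O (cr Ac))) Pc))))
  pattern-leaf {τ} {A} {ι} {P} {c} (leaf {a} {b} M Aa Ab τa a≢b G R) O Ac Pc Pτc = cases (c ≟ a)
    where
      cases : Dec (c ≡ a) → ι c ≡ τ c
      cases (yes refl) = trans (ι-a G) (sym τa)
      cases (no na) = trans (sym (other G na nb)) (trans
        (pattern-leaf R (oriented-cut f Aa Ab τa a≢b G O) (trans (off-other A na nb) Ac)
          (trans (set-other P true na) Pc)
          (trans (cong (P [ a ≔ true ]) skip≡) (trans (set-other P true τc≢a) Pτc)))
        skip≡)
        where
          nb : c ≢ b
          nb refl = true≢false (leaf-in f Aa Ab τa a≢b G O) Pc
          τc≢a : τ c ≢ a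
          τc≢a e = true≢false Pτc (trans (cong P e) (leaf-out f Aa Ab τa a≢b G O))
          skip≡ : skip₂ τ a b c ≡ τ c
          skip≡ = trans (skip-miss (skip τ a) b nb
              (λ e → na (τ-inj (faces M) (trans (sym (skip-miss τ a na τc≢a)) (trans e (sym τa))))))
            (skip-miss τ a na τc≢a)

  -- By `flip`, `ι` maps each side of the balance into the other; inactive points are fixed and
  -- counted on both sides.
  oriented⇒balanced : ∀ {τ A ι P} → Oriented f τ A ι P → Balanced A P
  oriented⇒balanced {τ} {A} {ι} {P} O = ≤-antisym
    (cnt-inj (λ i _ → ι i) to λ _ _ _ _ → ι-inj M)
    (cnt-inj (λ i _ → ι i) from λ _ _ _ _ → ι-inj M)
    where
      M = gluing O
      to : ∀ i → P i ≡ true → not (P (ι i) ∧ A (ι i)) ≡ true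
      to i Pi with A i in Ai
      ... | true  rewrite flip O Ai | Pi = refl
      ... | false rewrite ι-fix M Ai | Ai = cong not (∧-zeroʳ _)
      from : ∀ i → not (P i ∧ A i) ≡ true → P (ι i) ≡ true
      from i e with A i in Ai
      ... | false rewrite ι-fix M Ai = inactive-in O Ai
      ... | true  rewrite flip O Ai with P i
      ...   | false = refl

  oriented⇒reducible : ∀ {τ A ι P} → Oriented f τ A ι P → Reducible τ A ι
  oriented⇒reducible O = reduce (<-wellFounded _) (gluing O) (transversal O) (oriented⇒balanced O)

-- Gluings with a prescribed orientation

on? : ∀ b → b ≡ true ⊎ b ≡ false
on? true  = inj₁ refl
on? false = inj₂ refl

cnt-zero : ∀ {n} {P : Fin n → Bool} → (∀ i → P i ≡ false) → cnt P ≡ 0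
cnt-zero {zero}  e = refl
cnt-zero {suc n} e = cong₂ _+_ (cong bit (e zero)) (cnt-zero (e ∘ suc))

module _ {n : ℕ} (f : Fin n → Bool) where

  -- Gluings are compared pointwise; they become equal as objects only once they are tabulated as
  -- vectors.
  record Solutions (τ : Fin n → Fin n) (A P : Fin n → Bool) (h : ℕ) : Set where
    field
      sol      : Fin h → Fin n → Fin n
      good     : ∀ j → Oriented f τ A (sol j) P
      distinct : ∀ {j k} → sol j ≗ sol k → j ≡ k
      complete : ∀ {ι} → Oriented f τ A ι P → ∃ λ j → sol j ≗ ι

  open Solutions

  -- For an oriented gluing this is the length of the cycle. Truncation gives 0 for a negative
  -- excess, where no gluing exists.
  height : (A P : Fin n → Bool) → ℕ
  height A P = cnt (λ i → f i ∧ (A i ∧ P i)) ∸ cnt (λ i → f i ∧ (A i ∧ not (P i)))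

  -- The two sides of a leaf lie in one face with different letters: both counts drop by one, or
  -- neither changes.
  height-cut : ∀ {A P a b} → a ≢ b → f a ≡ f b → A a ≡ true → A b ≡ true → P a ≡ false → P b ≡ true →
    height (off A a b) (P [ a ≔ true ]) ≡ height A P
  height-cut {A} {P} {a} {b} a≢b fab Aa Ab Pa Pb = cases (f a) refl
    where
      A' P' : Fin n → Bool
      A' = off A a b
      P' = P [ a ≔ true ]

      in≡ : ∀ i → i ≢ b → (A' i ∧ P' i) ≡ (A i ∧ P i)
      in≡ i nb = go (i ≟ a)
        where
          go : Dec (i ≡ a) → (A' i ∧ P' i) ≡ (A i ∧ P i)
          go (yes refl) = trans (cong (_∧ P' a) (off-a A {a} {b})) (sym (trans (cong (A a ∧_) Pa) (∧-zeroʳ _)))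
          go (no na) = cong₂ _∧_ (off-other A na nb) (set-other P true na)

      in-b : A' b ∧ P' b ≡ false
      in-b = cong (_∧ P' b) (off-b A {a} {b})

      out≡ : ∀ i → i ≢ a → (A' i ∧ not (P' i)) ≡ (A i ∧ not (P i))
      out≡ i na = go (i ≟ b)
        where
          go : Dec (i ≡ b) → (A' i ∧ not (P' i)) ≡ (A i ∧ not (P i))
          go (yes refl) = trans (cong (_∧ not (P' b)) (off-b A {a} {b}))
            (sym (trans (cong (λ x → A b ∧ not x) Pb) (∧-zeroʳ _)))
          go (no nb) = cong₂ (λ x y → x ∧ not y) (off-other A na nb) (set-other P true na)

      out-a : A' a ∧ not (P' a) ≡ false
      out-a = cong (_∧ not (P' a)) (off-a A {a} {b})

      cases : ∀ v → f a ≡ v → height A' P' ≡ height A P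
      cases true fa = sym (cong₂ _∸_
        (cnt-remove b (cong₂ _∧_ fb (cong₂ _∧_ Ab Pb)) (trans (cong (f b ∧_) in-b) (∧-zeroʳ _))
          λ i ni → cong (f i ∧_) (in≡ i ni))
        (cnt-remove a (cong₂ _∧_ fa (cong₂ _∧_ Aa (cong not Pa))) (trans (cong (f a ∧_) out-a) (∧-zeroʳ _))
          λ i ni → cong (f i ∧_) (out≡ i ni)))
        where
          fb : f b ≡ true
          fb = trans (sym fab) fa
      cases false fa = cong₂ _∸_ (cnt-cong λ i → go-in i (i ≟ b)) (cnt-cong λ i → go-out i (i ≟ a))
        where
          go-in : ∀ i → Dec (i ≡ b) → (f i ∧ (A' i ∧ P' i)) ≡ (f i ∧ (A i ∧ P i))
          go-in i (yes refl) rewrite trans (sym fab) fa = refl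
          go-in i (no ni) = cong (f i ∧_) (in≡ i ni)
          go-out : ∀ i → Dec (i ≡ a) → (f i ∧ (A' i ∧ not (P' i))) ≡ (f i ∧ (A i ∧ not (P i)))
          go-out i (yes refl) rewrite fa = refl
          go-out i (no ni) = cong (f i ∧_) (out≡ i ni)

  -- The edge from `a` to `τ a` is forced by `pattern-leaf`, so every solution arises from a smaller
  -- one by adding it.
  solutions-glue : ∀ {τ A P a h} → Faces f τ A → A a ≡ true → P a ≡ false → P (τ a) ≡ true →
    Solutions (skip₂ τ a (τ a)) (off A a (τ a)) (P [ a ≔ true ]) h → Solutions τ A P h
  solutions-glue {τ} {A} {P} {a} {h} F Aa Pa Pb S = record
    { sol      = λ j → sol S j [ a ≔ b ] [ b ≔ a ]
    ; good     = λ j → oriented-glue f Aa Ab refl a≢b (G j) F Pa Pb (λ na → sym (set-other P true na)) (good S j)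
    ; distinct = λ {j} {k} e → distinct S λ i → same j k e i (i ≟ a) (i ≟ b)
    ; complete = comp
    }
    where
      b = τ a
      Ab = A-τ F Aa
      a≢b : a ≢ b
      a≢b e = true≢false Pb (trans (cong P (sym e)) Pa)

      fixed-a : ∀ j → sol S j a ≡ a
      fixed-a j = ι-fix (gluing (good S j)) (off-a A {a} {b})
      fixed-b : ∀ j → sol S j b ≡ b
      fixed-b j = ι-fix (gluing (good S j)) (off-b A {a} {b})

      G : ∀ j → Glued a b (sol S j [ a ≔ b ] [ b ≔ a ]) (sol S j)
      G j = glue-glued (sol S j) a≢b (fixed-a j) (fixed-b j)

      same : ∀ j k → (sol S j [ a ≔ b ] [ b ≔ a ]) ≗ (sol S k [ a ≔ b ] [ b ≔ a ]) →
        ∀ i → Dec (i ≡ a) → Dec (i ≡ b) → sol S j i ≡ sol S k i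
      same j k e i (yes refl) _ = trans (fixed-a j) (sym (fixed-a k))
      same j k e i _ (yes refl) = trans (fixed-b j) (sym (fixed-b k))
      same j k e i (no na) (no nb) = trans (other (G j) na nb) (trans (e i) (sym (other (G k) na nb)))

      comp : ∀ {ι} → Oriented f τ A ι P → ∃ λ j → (sol S j [ a ≔ b ] [ b ≔ a ]) ≗ ι
      comp {ι} O with pattern-leaf f (oriented⇒reducible f O) O Aa Pa Pb
      ... | ιa with cut-glued ι ιa (trans (cong ι (sym ιa)) (ι-invol (gluing O) a))
      ...   | H with complete S (oriented-cut f Aa Ab refl a≢b H O)
      ...     | j , e = j , λ i → go i (i ≟ a) (i ≟ b)
        where
          go : ∀ i → Dec (i ≡ a) → Dec (i ≡ b) → (sol S j [ a ≔ b ] [ b ≔ a ]) i ≡ ι i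
          go i (yes refl) _ = trans (ι-a (G j)) (sym ιa)
          go i _ (yes refl) = trans (ι-b (G j)) (sym (ι-b H))
          go i (no na) (no nb) = trans (sym (other (G j) na nb)) (trans (e i) (other H na nb))

  module _ {τ : Fin n → Fin n} {A P : Fin n → Bool} {x₀ y₀ : Fin n}
           (F : Faces f τ A) (act : ∀ {i} → A i ≡ true → P i ≡ f i)
           (inact : ∀ {i} → A i ≡ false → P i ≡ true) (bal : Balanced A P)
           (Ax : A x₀ ≡ true) (fx : f x₀ ≡ false) (Ay : A y₀ ≡ true) (fy : f y₀ ≡ true) where

    private
      -- Base points of the two faces; the pairing with parameter j matches τ^i (pt c) with
      -- τ^(j-i) (pt (not c)).
      pt : Bool → Fin n
      pt true  = y₀
      pt false = x₀

      A-pt : ∀ c → A (pt c) ≡ true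
      A-pt true  = Ay
      A-pt false = Ax

      f-pt : ∀ c → f (pt c) ≡ c
      f-pt true  = fy
      f-pt false = fx

      A-iter : ∀ k {z} → A z ≡ true → A (iter τ k z) ≡ true
      A-iter zero    e = e
      A-iter (suc k) e = A-τ F (A-iter k e)

      f-iter : ∀ k z → f (iter τ k z) ≡ f z
      f-iter zero    z = refl
      f-iter (suc k) z = trans (f-τ F _) (f-iter k z)

      side : Bool → Fin n → Bool
      side true  i = f i ∧ A i
      side false i = not (f i) ∧ A i

      side-in : ∀ c {z} → A z ≡ true → f z ≡ c → side c z ≡ true
      side-in true  Az fz = cong₂ _∧_ fz Az
      side-in false Az fz = cong₂ (λ x y → not x ∧ y) fz Az

      side-out : ∀ c {z} → side c z ≡ true → A z ≡ true × f z ≡ c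
      side-out true  {z} e with f z | A z
      ... | true | true = refl , refl
      side-out false {z} e with f z | A z
      ... | false | true = refl , refl

      -- On active points `P` is the second face, so after cancelling the inactive points the
      -- balance compares the two faces.
      side-cnt : cnt (side false) ≡ cnt (side true)
      side-cnt = sym (+-cancelʳ-≡ _ _ _ (trans (sym P≡) (trans bal U≡)))
        where
          inactive : Fin n → Bool
          inactive i = not (A i)
          P≡ : cnt P ≡ cnt (side true) + cnt inactive
          P≡ = trans (cnt-split P A) (cong₂ _+_ (cnt-cong here) (cnt-cong there))
            where
              here : ∀ i → P i ∧ A i ≡ f i ∧ A i
              here i with A i in Ai
              ... | true  = cong (_∧ true) (act Ai)
              ... | false = trans (∧-zeroʳ _) (sym (∧-zeroʳ _))
              there : ∀ i → P i ∧ not (A i) ≡ not (A i)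
              there i with A i in Ai
              ... | true  = ∧-zeroʳ _
              ... | false = cong (_∧ true) (inact Ai)
          U≡ : cnt (λ i → not (P i ∧ A i)) ≡ cnt (side false) + cnt inactive
          U≡ = trans (cnt-split _ A) (cong₂ _+_ (cnt-cong here) (cnt-cong there))
            where
              here : ∀ i → not (P i ∧ A i) ∧ A i ≡ not (f i) ∧ A i
              here i with A i in Ai
              ... | true  = cong (_∧ true) (cong not (trans (cong (_∧ true) (act Ai)) (∧-identityʳ _)))
              ... | false = trans (∧-zeroʳ _) (sym (∧-zeroʳ _))
              there : ∀ i → not (P i ∧ A i) ∧ not (A i) ≡ not (A i)
              there i with A i in Ai
              ... | true  = ∧-zeroʳ _
              ... | false = cong (_∧ true) (cong not (∧-zeroʳ _))

      side-period : ∀ c {q} → Period τ (τ-inj F) (pt c) q → cnt (side c) ≡ suc q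
      side-period c per = orbit-cnt τ (τ-inj F) per
        (λ k → side-in c (A-iter k (A-pt c)) (trans (f-iter k _) (f-pt c)))
        λ q → orbit F (A-pt c) (proj₁ (side-out c q)) (trans (f-pt c) (sym (proj₂ (side-out c q))))

      common-period : ∃ λ p → ∀ c → Period τ (τ-inj F) (pt c) p
      common-period with period τ (τ-inj F) x₀ | period τ (τ-inj F) y₀
      ... | p , perX | q , perY = p , λ
        { true  → subst (Period τ (τ-inj F) y₀)
            (suc-injective (trans (sym (side-period true perY)) (trans (sym side-cnt) (side-period false perX)))) perY
        ; false → perX }

    private module Links {p : ℕ} (per : ∀ c → Period τ (τ-inj F) (pt c) p) where

      m : ℕ
      m = suc p

      infix 4 _~_
      -- Congruence modulo the common face length `m`, stated through the action of `τ` so that it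
      -- need not be computed with remainders.
      record _~_ (i j : ℕ) : Set where
        constructor mk
        field at : ∀ c → iter τ i (pt c) ≡ iter τ j (pt c)
      open _~_ public

      ~-sym : ∀ {i j} → i ~ j → j ~ i
      ~-sym e = mk λ c → sym (at e c)

      ~-trans : ∀ {i j k} → i ~ j → j ~ k → i ~ k
      ~-trans e e' = mk λ c → trans (at e c) (at e' c)

      ~-reflexive : ∀ {i j} → i ≡ j → i ~ j
      ~-reflexive refl = mk λ _ → refl

      ~-+ˡ : ∀ k {i j} → i ~ j → k + i ~ k + j
      ~-+ˡ k e = mk λ c → trans (iter-+ τ k _ _) (trans (cong (iter τ k) (at e c)) (sym (iter-+ τ k _ _)))

      ~-+ʳ : ∀ k {i j} → i ~ j → i + k ~ j + k
      ~-+ʳ k {i} {j} e = ~-trans (~-reflexive (+-comm i k)) (~-trans (~-+ˡ k e) (~-reflexive (+-comm k j)))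

      ~-cancel : ∀ k {i j} → k + i ~ k + j → i ~ j
      ~-cancel k e = mk λ c → iter-inj τ (τ-inj F) k (trans (sym (iter-+ τ k _ _)) (trans (at e c) (iter-+ τ k _ _)))

      m~0 : m ~ 0
      m~0 = mk λ c → Period.loop (per c)

      %-~ : ∀ k → k % m ~ k
      %-~ k = mk λ c → iter-% τ p (at m~0 c) k

      ~-< : ∀ c {i j} → i < m → j < m → iter τ i (pt c) ≡ iter τ j (pt c) → i ≡ j
      ~-< c = iter-distinct τ (τ-inj F) (per c)

      -- Both faces have length `m`, so one base point decides for the other.
      transfer : ∀ c {i j} → iter τ i (pt c) ≡ iter τ j (pt c) → i ~ j
      transfer c {i} {j} e = ~-trans (~-sym (%-~ i)) (~-trans
        (~-reflexive (~-< c (m%n<n i m) (m%n<n j m) (trans (at (%-~ i) c) (trans e (sym (at (%-~ j) c))))))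
        (%-~ j))

      ex-of : ∀ {z} → A z ≡ true → ∃ λ i → i < m × iter τ i (pt (f z)) ≡ z
      ex-of {z} Az = index τ (τ-inj F) (per (f z)) (orbit F (A-pt _) Az (f-pt _))

      ex : Fin n → ℕ
      ex z with A z ≟ᵇ true
      ... | yes e = proj₁ (ex-of e)
      ... | no _  = 0

      ex-≤ : ∀ z → ex z ≤ m
      ex-≤ z with A z ≟ᵇ true
      ... | yes e = <⇒≤ (proj₁ (proj₂ (ex-of e)))
      ... | no _  = z≤n

      ex-iter : ∀ {z} → A z ≡ true → iter τ (ex z) (pt (f z)) ≡ z
      ex-iter {z} Az with A z ≟ᵇ true
      ... | yes e = proj₂ (proj₂ (ex-of e))
      ... | no ne = ⊥-elim (ne Az)

      ex-unique : ∀ {z} k c → A z ≡ true → f z ≡ c → iter τ k (pt c) ≡ z → k ~ ex z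
      ex-unique k c Az refl e = transfer c (trans e (sym (ex-iter Az)))

      ex-τ : ∀ {z} → A z ≡ true → ex (τ z) ~ suc (ex z)
      ex-τ {z} Az = ~-sym (ex-unique (suc (ex z)) (f z) (A-τ F Az) (f-τ F z) (cong τ (ex-iter Az)))

      -- The exponent stands for `J - ex z` modulo `m`; since `ex z ≤ m`, the subtraction from `m`
      -- is exact.
      link : ℕ → Fin n → Fin n
      link J z = if A z then iter τ (J + (m ∸ ex z)) (pt (not (f z))) else z

      link-act : ∀ J {z} → A z ≡ true → link J z ≡ iter τ (J + (m ∸ ex z)) (pt (not (f z)))
      link-act J {z} e = cong (λ b → if b then iter τ (J + (m ∸ ex z)) (pt (not (f z))) else z) e

      link-inact : ∀ J {z} → A z ≡ false → link J z ≡ z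
      link-inact J {z} e = cong (λ b → if b then iter τ (J + (m ∸ ex z)) (pt (not (f z))) else z) e

      A-link : ∀ J {z} → A z ≡ true → A (link J z) ≡ true
      A-link J {z} Az = trans (cong A (link-act J Az)) (A-iter (J + (m ∸ ex z)) (A-pt _))

      f-link : ∀ J {z} → A z ≡ true → f (link J z) ≡ not (f z)
      f-link J {z} Az = trans (cong f (link-act J Az)) (trans (f-iter (J + (m ∸ ex z)) _) (f-pt _))

      shift : ∀ J z → ex z + (J + (m ∸ ex z)) ~ J
      shift J z = ~-trans (~-reflexive eq) (~-trans (~-+ˡ J m~0) (~-reflexive (+-comm J 0)))
        where
          eq : ex z + (J + (m ∸ ex z)) ≡ J + m
          eq = trans (sym (+-assoc (ex z) J _)) (trans (cong (_+ (m ∸ ex z)) (+-comm (ex z) J))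
                 (trans (+-assoc J (ex z) _) (cong (J +_) (m+[n∸m]≡n (ex-≤ z)))))

      -- Together with `⇒link` this describes the pairing by an equation symmetric in both ends,
      -- from which the involution property follows.
      link⇒ : ∀ J {z} → A z ≡ true → ex z + ex (link J z) ~ J
      link⇒ J {z} Az = ~-trans
        (~-+ˡ (ex z) (~-sym (ex-unique (J + (m ∸ ex z)) (not (f z)) (A-link J Az) (f-link J Az) (sym (link-act J Az)))))
        (shift J z)

      ⇒link : ∀ J {z w} → A z ≡ true → A w ≡ true → f w ≡ not (f z) → ex z + ex w ~ J → link J z ≡ w
      ⇒link J {z} {w} Az Aw fw e = trans (link-act J Az) (trans
        (at (~-sym (~-cancel (ex z) (~-trans e (~-sym (shift J z))))) (not (f z)))
        (trans (cong (λ c → iter τ (ex w) (pt c)) (sym fw)) (ex-iter Aw)))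

      link-invol : ∀ J z → link J (link J z) ≡ z
      link-invol J z with on? (A z)
      ... | inj₁ Az = ⇒link J (A-link J Az) Az
              (sym (trans (cong not (f-link J Az)) (not-involutive _)))
              (~-trans (~-reflexive (+-comm _ (ex z))) (link⇒ J Az))
      ... | inj₂ ne = trans (cong (link J) (link-inact J ne)) (link-inact J ne)

      link-τ : ∀ J {z} → A z ≡ true → τ (link J (τ z)) ≡ link J z
      link-τ J {z} Az = sym (⇒link J Az (A-τ F (A-link J (A-τ F Az)))
        (trans (f-τ F _) (trans (f-link J (A-τ F Az)) (cong not (f-τ F z))))
        (~-trans (~-+ˡ (ex z) (ex-τ (A-link J (A-τ F Az))))
          (~-trans (~-reflexive (+-suc (ex z) _))
            (~-trans (~-+ʳ (ex (link J (τ z))) (~-sym (ex-τ Az))) (link⇒ J (A-τ F Az))))))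

      link-gluing : ∀ J → Gluing f τ A (link J)
      link-gluing J = record
        { faces = F
        ; ι-invol = link-invol J
        ; ι-fix = link-inact J
        ; ι-act = λ Az e → b≢not (trans (sym (cong f e)) (f-link J Az))
        ; crossing = x₀ , fx , trans (f-link J Ax) (cong not fx)
        }

      link-oriented : ∀ J → Oriented f τ A (link J) P
      link-oriented J = core-oriented f (link-gluing J) φφ (f-link J) act inact
        where
          φφ : ∀ i → τ (link J (τ (link J i))) ≡ i
          φφ i with on? (A i)
          ... | inj₁ Ai = trans (link-τ J (A-link J Ai)) (link-invol J i)
          ... | inj₂ ne = trans (cong (τ ∘ link J ∘ τ) li) (trans (cong (τ ∘ link J) ti) (trans (cong τ li) ti))
            where
              li = link-inact J ne
              ti = τ-fix F ne

      module _ {ι : Fin n → Fin n} (O : Oriented f τ A ι P) where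

        crosses : ∀ {z} → A z ≡ true → f (ι z) ≡ not (f z)
        crosses Az = trans (sym (act (A-ι (gluing O) Az))) (trans (flip O Az) (cong not (act Az)))

        J₀ : ℕ
        J₀ = (ex x₀ + ex (ι x₀)) % m

        -- All edges cross, so there is no leaf and `no-leaf⇒φφ` applies. One step forward on one
        -- side is one step back on the other, which keeps the sum of the two exponents constant and
        -- equal to its value at `x₀`.
        τιτ : ∀ {z} → A z ≡ true → τ (ι (τ z)) ≡ ι z
        τιτ {z} _ = trans (cong (τ ∘ ι ∘ τ) (sym (ι-invol (gluing O) z)))
          (no-leaf⇒φφ f (gluing O) (transversal O) bal
            (λ Ab e → b≢not (trans (cong f (sym e)) (trans (f-τ F _) (crosses Ab)))) (ι z))

        sum-false : ∀ {z} → A z ≡ true → f z ≡ false → ex z + ex (ι z) ~ J₀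
        sum-false {z} Az fz = proj₂ (reach-closed (λ z → A z ≡ true × (ex z + ex (ι z) ~ J₀)) step
            (orbit F Ax Az (trans fx (sym fz))) (Ax , ~-sym (%-~ (ex x₀ + ex (ι x₀)))))
          where
            step : ∀ {z} → A z ≡ true × (ex z + ex (ι z) ~ J₀) → A (τ z) ≡ true × (ex (τ z) + ex (ι (τ z)) ~ J₀)
            step {z} (Az , e) = A-τ F Az ,
              ~-trans (~-+ʳ (ex (ι (τ z))) (ex-τ Az))
                (~-trans (~-reflexive (sym (+-suc (ex z) _)))
                  (~-trans (~-+ˡ (ex z) (~-trans (~-sym (ex-τ (A-ι (gluing O) (A-τ F Az))))
                    (~-reflexive (cong ex (τιτ Az))))) e))

        sum : ∀ {z} → A z ≡ true → ex z + ex (ι z) ~ J₀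
        sum {z} Az with f z in fz
        ... | false = sum-false Az fz
        ... | true  = ~-trans
                (~-reflexive (trans (+-comm (ex z) _) (cong (λ w → ex (ι z) + ex w) (sym (ι-invol (gluing O) z)))))
                (sum-false (A-ι (gluing O) Az) (trans (crosses Az) (cong not fz)))

        is-link : link J₀ ≗ ι
        is-link z with on? (A z)
        ... | inj₁ Az = ⇒link J₀ Az (A-ι (gluing O) Az) (crosses Az) (sum Az)
        ... | inj₂ ne = trans (link-inact J₀ ne) (sym (ι-fix (gluing O) ne))

    core-solutions : Solutions τ A P (cnt (λ i → f i ∧ A i))
    core-solutions with common-period
    ... | p , per = subst (Solutions τ A P) (sym (side-period true (per true))) record
        { sol      = λ j → link (toℕ j)
        ; good     = λ j → link-oriented (toℕ j)
        ; distinct = λ {j} {k} e → toℕ-injective (~-< true (toℕ<n j) (toℕ<n k)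
            (at (~-trans (~-sym (link⇒ (toℕ j) Ax))
              (~-trans (~-reflexive (cong (λ w → ex x₀ + ex w) (e x₀))) (link⇒ (toℕ k) Ax))) true))
        ; complete = λ {ι} O → fromℕ< (m%n<n (ex x₀ + ex (ι x₀)) m) ,
            λ z → trans (cong (λ J → link J z) (toℕ-fromℕ< (m%n<n (ex x₀ + ex (ι x₀)) m))) (is-link O z)
        }
      where open Links per

  -- As long as `true` follows `false` somewhere in a face, a leaf is forced. Otherwise the letters
  -- are constant on each face, and only `false` on the first with `true` on the second admits
  -- gluings.
  enumerate : ∀ {τ A P} → Acc _<_ (cnt A) → Faces f τ A → (∀ {i} → A i ≡ false → P i ≡ true) →
    Balanced A P → Solutions τ A P (height A P)
  enumerate {τ} {A} {P} (acc rec) F inact bal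
    with any? (λ c → A c ≟ᵇ true ×-dec P c ≟ᵇ false ×-dec P (τ c) ≟ᵇ true)
  ... | yes (a , Aa , Pa , Pb) = solutions-glue F Aa Pa Pb
          (subst (Solutions _ _ _) (height-cut a≢b (sym (f-τ F a)) Aa Ab Pa Pb)
            (enumerate (rec (cnt-off A a≢b Aa Ab)) (faces-skip₂ f F a (τ a)) inact'
              (balanced-cut {A = A} {P} Pa Pb Ab bal)))
    where
      Ab = A-τ F Aa
      a≢b : a ≢ τ a
      a≢b e = true≢false Pb (trans (cong P (sym e)) Pa)
      inact' : ∀ {i} → off A a (τ a) i ≡ false → (P [ a ≔ true ]) i ≡ true
      inact' {i} e = go (i ≟ a) (i ≟ τ a)
        where
          go : Dec (i ≡ a) → Dec (i ≡ τ a) → (P [ a ≔ true ]) i ≡ true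
          go (yes refl) _ = set-same P a true
          go (no na) (yes refl) = trans (set-other P true na) Pb
          go (no na) (no nb) = trans (set-other P true na) (inact (trans (sym (off-other A na nb)) e))
  ... | no none = cases (any? (λ x → A x ≟ᵇ true ×-dec f x ≟ᵇ false ×-dec P x ≟ᵇ false))
                        (any? (λ y → A y ≟ᵇ true ×-dec f y ≟ᵇ true ×-dec P y ≟ᵇ true))
    where
      out-const : ∀ {i j} → A i ≡ true → A j ≡ true → f i ≡ f j → P i ≡ false → P j ≡ false
      out-const Ai Aj e Pi = proj₂ (reach-closed (λ z → A z ≡ true × P z ≡ false)
        (λ { (Az , Pz) → A-τ F Az , ¬-not λ Pτz → none (_ , Az , Pz , Pτz) }) (orbit F Ai Aj e) (Ai , Pi))

      sources : ∀ {ι} → Oriented f τ A ι P →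
        (∃ λ x → A x ≡ true × f x ≡ false × P x ≡ false) × (∃ λ y → A y ≡ true × f y ≡ true × P y ≡ true)
      sources {ι} O with crossing-at (gluing O) false
      ... | x , Ax , fx , fιx =
        (x , Ax , fx , Px) , (ι x , A-ι (gluing O) Ax , fιx , trans (flip O Ax) (cong not Px))
        where Px = trans (cross O (trans fιx (cong not (sym fx)))) fx

      no-solutions : (∀ {ι} → Oriented f τ A ι P → ⊥) → Solutions τ A P 0
      no-solutions none' = record
        { sol = λ () ; good = λ () ; distinct = λ { {()} } ; complete = λ O → ⊥-elim (none' O) }

      not-all-in : ∀ {y} → A y ≡ true → (∀ i → P i ≡ true) → ⊥
      not-all-in {y} Ay all = 1+n≰n (≤-trans (≤-reflexive (trans (sym P≡) bal))
        (cnt-inj (λ i _ → i) inside λ _ _ _ _ e → e))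
        where
          P≡ : cnt P ≡ suc (cnt (P [ y ≔ false ]))
          P≡ = cnt-remove y (all y) (set-same P y false) λ i ni → set-other P false ni
          inside : ∀ i → not (P i ∧ A i) ≡ true → (P [ y ≔ false ]) i ≡ true
          inside i e = trans (set-other P false λ { refl → true≢false e (cong not (cong₂ _∧_ (all y) Ay)) }) (all i)

      cases : Dec _ → Dec _ → Solutions τ A P (height A P)
      cases (yes (x₀ , Ax , fx , Px)) (yes (y₀ , Ay , fy , Py)) =
        subst (Solutions τ A P) (sym (cong₂ _∸_ (cnt-cong ins) (cnt-zero outs)))
          (core-solutions F act inact bal Ax fx Ay fy)
        where
          act : ∀ {i} → A i ≡ true → P i ≡ f i
          act {i} Ai with f i in fi
          ... | false = out-const Ax Ai (trans fx (sym fi)) Px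
          ... | true  = ¬-not λ Pi → true≢false Py (out-const Ai Ay (trans fi (sym fy)) Pi)
          ins : ∀ i → (f i ∧ (A i ∧ P i)) ≡ (f i ∧ A i)
          ins i with A i in Ai
          ... | false = refl
          ... | true rewrite act Ai with f i
          ...   | true  = refl
          ...   | false = refl
          outs : ∀ i → (f i ∧ (A i ∧ not (P i))) ≡ false
          outs i with A i in Ai
          ... | false = ∧-zeroʳ _
          ... | true rewrite act Ai with f i
          ...   | true  = refl
          ...   | false = refl
      -- Every point would be marked, against the balance.
      cases (no nx) (yes (y₀ , Ay , fy , Py)) = ⊥-elim (not-all-in Ay all)
        where
          all : ∀ i → P i ≡ true
          all i with on? (A i) | on? (f i)
          ... | inj₂ Ai | _ = inact Ai
          ... | inj₁ Ai | inj₁ fi = ¬-not λ Pi → true≢false Py (out-const Ai Ay (trans fi (sym fy)) Pi)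
          ... | inj₁ Ai | inj₂ fi = ¬-not λ Pi → nx (i , Ai , fi , Pi)
      -- A gluing would have a crossing edge, marked in the second face; so there is none, and the
      -- height is 0 as well.
      cases _ (no ny) = subst (Solutions τ A P) (sym (trans (cong (_∸ outs) (cnt-zero zeros)) (0∸n≡0 outs)))
        (no-solutions λ O → ny (proj₂ (sources O)))
        where
          outs = cnt (λ i → f i ∧ (A i ∧ not (P i)))
          parts : ∀ a b c → a ∧ (b ∧ c) ≡ true → b ≡ true × a ≡ true × c ≡ true
          parts true true true e = refl , refl , refl
          zeros : ∀ i → (f i ∧ (A i ∧ P i)) ≡ false
          zeros i = ¬-not λ e → ny (i , parts (f i) (A i) (P i) e)

-- The permutation τ

cnt-not : ∀ {n} (P : Fin n → Bool) → cnt P + cnt (not ∘ P) ≡ n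
cnt-not P = trans (sym (cnt-split (λ _ → true) P)) (cnt-all _)

everywhere : ∀ {n} → Fin n → Bool
everywhere _ = true

face : ∀ {n} → ℕ → Fin n → Bool
face m i = m ≤ᵇ toℕ i

≤ᵇ-true : ∀ {m n} → m ≤ n → (m ≤ᵇ n) ≡ true
≤ᵇ-true le = Equivalence.to T-≡ (≤⇒≤ᵇ le)

≤ᵇ-false : ∀ {m n} → n < m → (m ≤ᵇ n) ≡ false
≤ᵇ-false {m} {n} lt = ¬-not λ e → 1+n≰n (≤-trans lt (≤ᵇ⇒≤ m n (Equivalence.from T-≡ e)))

data Next (n m k : ℕ) : ℕ → Set where
  wrap₁ : suc k ≡ m → Next n m k 0
  wrap₂ : suc k ≢ m → suc k ≡ n → Next n m k m
  step  : suc k ≢ m → suc k ≢ n → Next n m k (suc k)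

next : ∀ n m k → Next n m k (τℕ n m k)
next n m k with suc k ≡ᵇ m in e
... | true  = wrap₁ (≡ᵇ⇒≡ (suc k) m (Equivalence.from T-≡ e))
... | false with suc k ≡ᵇ n in e'
...   | true  = wrap₂ (λ p → true≢false (Equivalence.to T-≡ (≡⇒≡ᵇ (suc k) m p)) e) (≡ᵇ⇒≡ (suc k) n (Equivalence.from T-≡ e'))
...   | false = step (λ p → true≢false (Equivalence.to T-≡ (≡⇒≡ᵇ (suc k) m p)) e)
                     (λ p → true≢false (Equivalence.to T-≡ (≡⇒≡ᵇ (suc k) n p)) e')

module _ {n' m : ℕ} (1≤m : 1 ≤ m) (m<n : m < suc n') where

  private
    n = suc n'

  next-< : ∀ {k l} → k < n → Next n m k l → l < n
  next-< k<n (wrap₁ _)   = s≤s z≤n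
  next-< k<n (wrap₂ _ _) = m<n
  next-< k<n (step _ ne) = ≤∧≢⇒< k<n ne

  next-inj : ∀ {k k' l l'} → Next n m k l → Next n m k' l' → l ≡ l' → k ≡ k'
  next-inj (wrap₁ e)   (wrap₁ e')   _ = suc-injective (trans e (sym e'))
  next-inj (wrap₁ _)   (wrap₂ _ _)  refl = ⊥-elim (1+n≰n 1≤m)
  next-inj (wrap₂ _ _) (wrap₁ _)    refl = ⊥-elim (1+n≰n 1≤m)
  next-inj (wrap₂ _ e) (wrap₂ _ e') _ = suc-injective (trans e (sym e'))
  next-inj (wrap₂ _ _) (step ne _)  e = ⊥-elim (ne (sym e))
  next-inj (step ne _) (wrap₂ _ _)  e = ⊥-elim (ne e)
  next-inj (step _ _)  (step _ _)   e = suc-injective e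

  next-face : ∀ {k l} → Next n m k l → (m ≤ᵇ l) ≡ (m ≤ᵇ k)
  next-face {k} (wrap₁ refl) = sym (≤ᵇ-false {suc k} {k} ≤-refl)
  next-face (wrap₂ _ e) = trans (≤ᵇ-true {m} {m} ≤-refl)
    (sym (≤ᵇ-true (case (subst (m <_) (sym e) m<n))))
    where
      case : ∀ {k} → m < suc k → m ≤ k
      case (s≤s p) = p
  next-face {k} (step ne _) with m ≤? k
  ... | yes le = trans (≤ᵇ-true (≤-trans le (n≤1+n k))) (sym (≤ᵇ-true le))
  ... | no nle = trans (≤ᵇ-false lt) (sym (≤ᵇ-false (≤-trans (n≤1+n (suc k)) lt)))
    where
      lt : suc k < m
      lt = ≤∧≢⇒< (≰⇒> nle) ne

  toℕ-τ : ∀ (i : Fin n) → toℕ (τ m i) ≡ τℕ n m (toℕ i)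
  toℕ-τ i = trans (toℕ-fromℕ< _) (m<n⇒m%n≡m (next-< (toℕ<n i) (next n m (toℕ i))))

  next-τ : ∀ (i : Fin n) → Next n m (toℕ i) (toℕ (τ m i))
  next-τ i = subst (Next n m (toℕ i)) (sym (toℕ-τ i)) (next n m (toℕ i))

  τ-injective : Inj (τ {n} m)
  τ-injective {i} {j} e = toℕ-injective (next-inj (next-τ i) (next-τ j) (cong toℕ e))

  face-τ : ∀ (i : Fin n) → face m (τ m i) ≡ face m i
  face-τ i = next-face (next-τ i)

  -- On the way up inside one face `τ` never wraps around, so it acts as the successor.
  reach-up : ∀ d {i j : Fin n} → toℕ j ≡ d + toℕ i → face m i ≡ face m j → Reach (τ m) i j
  reach-up zero    e _ rewrite toℕ-injective e = ε
  reach-up (suc d) {i} {j} e ef = refl ◅ reach-up d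
    (trans e (trans (sym (+-suc d _)) (cong (d +_) (sym τi)))) (trans (face-τ i) ef)
    where
      i<j : toℕ i < toℕ j
      i<j = subst (toℕ i <_) (sym e) (s≤s (m≤n+m _ d))
      τi : toℕ (τ m i) ≡ suc (toℕ i)
      τi with toℕ (τ m i) | next-τ i
      ... | _ | step _ _  = refl
      ... | _ | wrap₁ e'  = ⊥-elim (true≢false
            (trans ef (≤ᵇ-true (subst (_≤ toℕ j) e' i<j))) (≤ᵇ-false (≤-reflexive e')))
      ... | _ | wrap₂ _ e' = ⊥-elim (1+n≰n (≤-trans (toℕ<n j) (subst (_≤ toℕ j) e' i<j)))

  τ-faces : Faces (face m) (τ {n} m) everywhere
  τ-faces = record
    { τ-inj = τ-injective
    ; τ-fix = λ ()
    ; f-τ   = face-τ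
    ; orbit = λ {i} {j} _ _ → orb i j
    }
    where
      orb : ∀ i j → face m i ≡ face m j → Reach (τ m) i j
      orb i j e with ≤-total (toℕ i) (toℕ j)
      ... | inj₁ le = reach-up (toℕ j ∸ toℕ i) (sym (m∸n+n≡m le)) e
      ... | inj₂ ge = reach-sym (τ m) τ-injective (reach-up (toℕ i ∸ toℕ j) (sym (m∸n+n≡m ge)) (sym e))

  module _ {ι : Fin n → Fin n} where

    -- The path changes face at some step, and that step belongs to `ι` because `τ` preserves faces.
    crossing-between : (∀ i → ι (ι i) ≡ i) → ∀ {i j} → Star (GenStep ι (τ m)) i j →
      face m i ≡ false → face m j ≡ true → ∃ λ x → face m x ≡ false × face m (ι x) ≡ true
    crossing-between inv ε fi fj = ⊥-elim (true≢false fj fi)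
    crossing-between inv {i} (_◅_ {j = k} s r) fi fj with face m k in fk
    ... | false = crossing-between inv r fk fj
    ... | true  = here s
      where
        here : GenStep ι (τ m) i k → ∃ λ x → face m x ≡ false × face m (ι x) ≡ true
        here (ι-fwd e) = i , fi , trans (cong (face m) e) fk
        here (ι-bwd e) = i , fi , trans (cong (face m) (trans (cong ι (sym e)) (inv k))) fk
        here (τ-fwd e) = ⊥-elim (true≢false (trans (cong (face m) e) fk) (trans (face-τ i) fi))
        here (τ-bwd e) = ⊥-elim (true≢false (trans (sym (cong (face m) e)) (trans (face-τ k) fk)) fi)

    transitive⇒crossing : (∀ i → ι (ι i) ≡ i) → Transitive⟨ ι , τ m ⟩ →
      ∃ λ x → face m x ≡ false × face m (ι x) ≡ true
    transitive⇒crossing inv tr = crossing-between inv (tr zero (fromℕ< m<n))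
      (≤ᵇ-false 1≤m) (≤ᵇ-true (≤-reflexive (sym (toℕ-fromℕ< m<n))))

    gluing⇒transitive : Gluing (face m) (τ m) everywhere ι → Transitive⟨ ι , τ m ⟩
    gluing⇒transitive G i j = cases (face m i ≟ᵇ face m j)
      where
        along : ∀ {i j} → face m i ≡ face m j → Star (GenStep ι (τ m)) i j
        along e = Star.map τ-fwd (orbit τ-faces refl refl e)
        cases : Dec (face m i ≡ face m j) → Star (GenStep ι (τ m)) i j
        cases (yes e) = along e
        cases (no ne) with crossing-at G (face m i)
        ... | x , _ , fx , fιx =
          along (sym fx) ◅◅ (ι-fwd refl ◅ along (trans fιx (sym (¬-not (ne ∘ sym)))))

    gluing-everywhere : (∀ i → ι (ι i) ≡ i) → (∀ i → ι i ≢ i) →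
      (∃ λ x → face m x ≡ false × face m (ι x) ≡ true) → Gluing (face m) (τ m) everywhere ι
    gluing-everywhere inv fpf cr = record
      { faces = τ-faces ; ι-invol = inv ; ι-fix = λ () ; ι-act = λ {i} _ → fpf i ; crossing = cr }

    -- The N cycle minima are half of all half-edges, which is the balance from which the reduction
    -- starts.
    genus0⇒reducible : ∀ {N} → n ≡ N + N → Gluing (face m) (τ m) everywhere ι →
      numCycles (τ m ∘ ι) ≡ N → Reducible (face m) (τ m) everywhere ι
    genus0⇒reducible {N} n≡ G e = reduce (face m) (<-wellFounded _) G T (trans P≡ (sym U≡))
      where
        P = isCycleMin (τ m ∘ ι)
        T = cycleMin-transversal (τ m ∘ ι) (φ-inj G)
        P≡ : cnt P ≡ N
        P≡ = trans (sym (numCycles-transversal (τ m ∘ ι) (φ-inj G) T)) e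
        U≡ : cnt (λ i → not (P i ∧ true)) ≡ N
        U≡ = trans (cnt-cong λ i → cong not (∧-identityʳ (P i)))
          (+-cancelˡ-≡ N _ _ (trans (cong (_+ cnt (not ∘ P)) (sym P≡)) (trans (cnt-not P) n≡)))

  oriented-half : ∀ {ι P N} → n ≡ N + N → Oriented (face m) (τ m) everywhere ι P → cnt P ≡ N
  oriented-half {ι} {P} {N} n≡ O = *-cancelˡ-≡ _ _ 2 (trans double (cong (N +_) (sym (+-identityʳ N))))
    where
      double : cnt P + (cnt P + 0) ≡ N + N
      double = trans (cong (cnt P +_) (trans (+-identityʳ _) (trans (oriented⇒balanced _ O)
          (cnt-cong λ i → cong not (∧-identityʳ (P i))))))
        (trans (cnt-not P) n≡)

  oriented⇒genus0 : ∀ {ι P N} → n ≡ N + N → Oriented (face m) (τ m) everywhere ι P → numCycles (τ m ∘ ι) ≡ N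
  oriented⇒genus0 n≡ O = trans (numCycles-transversal _ (φ-inj (gluing O)) (transversal O)) (oriented-half n≡ O)

-- Binomial sums

words : ℕ → ℕ → ℕ
words zero    zero    = 1
words zero    (suc q) = words zero q
words (suc p) zero    = words p zero
words (suc p) (suc q) = words p (suc q) + words (suc p) q

-- Recursion on the first letter: the front position contributes `p ∸ q` for every word, and all
-- other positions belong to the rest of the word.
codes : ℕ → ℕ → ℕ
codes zero    zero    = 0
codes zero    (suc q) = codes zero q
codes (suc p) zero    = suc p * words (suc p) zero + codes p zero
codes (suc p) (suc q) = (suc p ∸ suc q) * words (suc p) (suc q) + (codes p (suc q) + codes (suc p) q)

pascal : ∀ n k → suc n C suc k ≡ n C k + n C suc k
pascal n k = sym (nCk+nC[k+1]≡[n+1]C[k+1] n k)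

words-C : ∀ n p q → n ≡ p + q → words p q ≡ n C p
words-C zero    zero    zero    e = refl
words-C (suc n) zero    (suc q) e = words-C n zero q (suc-injective e)
words-C (suc n) (suc p) zero    e = trans (words-C n p zero (suc-injective e))
  (subst (λ k → k C p ≡ suc k C suc p) (sym (trans (suc-injective e) (+-identityʳ p)))
    (trans (nCn≡1 p) (sym (nCn≡1 (suc p)))))
words-C (suc n) (suc p) (suc q) e = trans
  (cong₂ _+_ (words-C n p (suc q) (suc-injective e))
             (words-C n (suc p) q (trans (suc-injective e) (+-suc p q))))
  (sym (pascal n p))

-- The identity (k+1) C(n,k+1) = (n-k) C(n,k) without subtraction.
absorption : ∀ n k → suc k * (n C suc k) + k * (n C k) ≡ n * (n C k)
absorption zero    zero    = refl
absorption zero    (suc k) = cong₂ _+_ (*-zeroʳ (suc (suc k))) (*-zeroʳ (suc k))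
absorption (suc n) zero    rewrite nC1≡n (suc n) = lemma n
  where lemma : ∀ n → 1 * suc n + 0 ≡ suc n * 1
        lemma = solve-∀
absorption (suc n) (suc k) rewrite pascal n (suc k) | pascal n k =
  trans (lemma₁ k (n C k) (n C suc k) (n C suc (suc k)))
    (trans (cong₂ (λ x y → x + y + (n C suc k + n C k)) (absorption n (suc k)) (absorption n k))
      (lemma₂ n (n C k) (n C suc k)))
  where
    lemma₁ : ∀ k x y z → suc (suc k) * (y + z) + suc k * (x + y) ≡
      (suc (suc k) * z + suc k * y) + (suc k * y + k * x) + (y + x)
    lemma₁ = solve-∀
    lemma₂ : ∀ n x y → n * y + n * x + (y + x) ≡ suc n * (x + y)
    lemma₂ = solve-∀

-- L n p = Σ_{i<p} C(n,i),  D n p = Σ_{i<p} (2(p-i)-1) C(n,i),  S n p = Σ_{i<p} (p-i)² C(n,i)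
L D S : ℕ → ℕ → ℕ
L n zero    = 0
L n (suc p) = L n p + n C p
D n zero    = 0
D n (suc p) = D n p + (L n p + L n (suc p))
S n zero    = 0
S n (suc p) = S n p + D n (suc p)

-- Pascal's rule summed along a row. It passes on to `D` and `S`; for `S` it is the recursion of
-- `codes` where `p ∸ q` vanishes.
L-suc : ∀ n p → L (suc n) (suc p) ≡ L n p + L n (suc p)
L-suc n zero    = refl
L-suc n (suc p) = trans (cong₂ _+_ (L-suc n p) (pascal n p)) (lemma (L n p) (L n (suc p)) (n C p) (n C suc p) refl)
  where
    lemma : ∀ a b c d → b ≡ a + c → a + b + (c + d) ≡ b + (b + d)
    lemma a b c d refl = ring a c d
      where ring : ∀ a c d → a + (a + c) + (c + d) ≡ (a + c) + ((a + c) + d)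
            ring = solve-∀

interchange : ∀ a b c d → a + b + (c + d) ≡ (a + c) + (b + d)
interchange = solve-∀

D-suc : ∀ n p → D (suc n) (suc p) ≡ D n p + D n (suc p)
D-suc n zero    = refl
D-suc n (suc p) = trans (cong₂ _+_ (D-suc n p) (cong₂ _+_ (L-suc n p) (L-suc n (suc p))))
  (lemma (D n p) (D n (suc p)) (L n p) (L n (suc p)) (L n (suc (suc p))) )
  where
    lemma : ∀ x y a b c → x + y + ((a + b) + (b + c)) ≡ (x + (a + b)) + (y + (b + c))
    lemma = solve-∀

S-suc : ∀ n p → S (suc n) (suc p) ≡ S n p + S n (suc p)
S-suc n zero    = refl
S-suc n (suc p) = trans (cong₂ _+_ (S-suc n p) (D-suc n (suc p)))
  (interchange (S n p) (S n (suc p)) (D n (suc p)) (D n (suc (suc p))))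

-- The point is the case n + 1 = 2p, in which the partial sums `L`, having no closed form, cancel.
D-closed : ∀ n p → D n p + suc n * L n p ≡ p * (n C p) + 2 * p * L n p
D-closed n zero    = *-zeroʳ (suc n)
D-closed n (suc p) = +-cancelʳ-≡ (p * (n C p)) _ _ (begin
  D n p + (L n p + (L n p + n C p)) + suc n * (L n p + n C p) + p * (n C p)
    ≡⟨ lemma₁ (D n p) n (L n p) (n C p) (p * (n C p)) ⟩
  (D n p + suc n * L n p) + (n * (n C p) + (2 * L n p + 2 * (n C p) + p * (n C p)))
    ≡⟨ cong₂ (λ x y → x + (y + (2 * L n p + 2 * (n C p) + p * (n C p)))) (D-closed n p) (sym (absorption n p)) ⟩
  (p * (n C p) + 2 * p * L n p) + ((suc p * (n C suc p) + p * (n C p)) + (2 * L n p + 2 * (n C p) + p * (n C p)))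
    ≡⟨ lemma₂ p (n C p) (suc p * (n C suc p)) (L n p) ⟩
  suc p * (n C suc p) + 2 * suc p * (L n p + n C p) + p * (n C p) ∎)
  where
    open ≡-Reasoning
    lemma₁ : ∀ d n l c x → d + (l + (l + c)) + suc n * (l + c) + x ≡ (d + suc n * l) + (n * c + (2 * l + 2 * c + x))
    lemma₁ = solve-∀
    lemma₂ : ∀ p c y l → (p * c + 2 * p * l) + ((y + p * c) + (2 * l + 2 * c + p * c)) ≡
      y + 2 * suc p * (l + c) + p * c
    lemma₂ = solve-∀

D-middle : ∀ n p → suc n ≡ 2 * p → D n p ≡ p * (n C p)
D-middle n p e = +-cancelʳ-≡ (2 * p * L n p) _ _
  (trans (cong (λ x → D n p + x * L n p) (sym e)) (D-closed n p))

codes-0 : ∀ q → codes 0 q ≡ 0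
codes-0 zero    = refl
codes-0 (suc q) = codes-0 q

-- Makes the two closed forms of `codes` agree one step beyond the diagonal.
S-above : ∀ n p → suc n ≡ 2 * suc p → 2 * S n p + suc n * (n C suc p) ≡ 2 * S n (suc p)
S-above n p e = trans (cong (λ x → 2 * S n p + x * (n C suc p)) e)
  (trans (lemma (S n p) (suc p) (n C suc p)) (cong (λ x → 2 * (S n p + x)) (sym (D-middle n (suc p) e))))
  where
    lemma : ∀ s p c → 2 * s + 2 * p * c ≡ 2 * (s + p * c)
    lemma = solve-∀

mutual
  codes-≤ : ∀ n p q → n ≡ p + q → p ≤ q → codes p q ≡ S n p
  codes-≤ n zero q _ _ = codes-0 q
  codes-≤ (suc n) (suc p) (suc q) e (s≤s p≤q) = begin
    (p ∸ q) * words (suc p) (suc q) + (codes p (suc q) + codes (suc p) q)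
      ≡⟨ cong₂ (λ x y → x * words (suc p) (suc q) + (y + codes (suc p) q)) (m≤n⇒m∸n≡0 p≤q)
           (codes-≤ n p (suc q) e₁ (m≤n⇒m≤1+n p≤q)) ⟩
    S n p + codes (suc p) q ≡⟨ cong (S n p +_) rest ⟩
    S n p + S n (suc p)     ≡⟨ S-suc n p ⟨
    S (suc n) (suc p)       ∎
    where
      open ≡-Reasoning
      e₁ = suc-injective e
      e₂ = trans e₁ (+-suc p q)
      rest : codes (suc p) q ≡ S n (suc p)
      rest with m≤n⇒m<n∨m≡n p≤q
      ... | inj₁ p<q  = codes-≤ n (suc p) q e₂ p<q
      -- Removing a letter `false` from a word with equally many of both leaves the region p ≤ q.
      ... | inj₂ refl = *-cancelˡ-≡ _ _ 2 (trans (codes-≥ n (suc p) p 1 e₂ (sym (+-comm p 1)))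
            (trans (cong (λ x → 2 * S n p + x) (+-identityʳ _)) (S-above n p (trans (cong suc e₁) (lemma p)))))
        where
          lemma : ∀ p → suc (p + suc p) ≡ 2 * suc p
          lemma = solve-∀

  -- A suffix of length l has average signed excess d l / n; summed over l = 1, ..., n and all words
  -- this is d (n+1) C(n,p) / 2. The negative parts, after exchanging the letters, add up to
  -- `codes q p`, which is `S n q`. The factor 2 avoids the division.
  codes-≥ : ∀ n p q d → n ≡ p + q → p ≡ q + d → 2 * codes p q ≡ 2 * S n q + d * (suc n * (n C p))
  codes-≥ n p q zero e e' = trans
    (cong (2 *_) (trans (codes-≤ n p q e (≤-reflexive p≡q)) (cong (S n) p≡q)))
    (sym (+-identityʳ _))
    where p≡q = trans e' (+-identityʳ q)
  codes-≥ (suc n) (suc p) zero (suc .p) e refl = begin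
    2 * (suc p * words p 0 + codes p 0)           ≡⟨ *-distribˡ-+ 2 (suc p * words p 0) _ ⟩
    2 * (suc p * words p 0) + 2 * codes p 0
      ≡⟨ cong (2 * (suc p * words p 0) +_) (codes-≥ n p 0 p (suc-injective e) refl) ⟩
    2 * (suc p * words p 0) + p * (suc n * (n C p))
      ≡⟨ cong (λ x → 2 * (suc p * words p 0) + p * (suc n * x)) (words-C n p 0 (suc-injective e)) ⟨
    2 * (suc p * words p 0) + p * (suc n * words p 0)
      ≡⟨ cong (λ k → 2 * (suc p * words p 0) + p * (suc k * words p 0)) n≡p ⟩
    2 * (suc p * words p 0) + p * (suc p * words p 0) ≡⟨ lemma p (words p 0) ⟩
    suc p * (suc (suc p) * words p 0)
      ≡⟨ cong₂ (λ k x → suc p * (suc (suc k) * x)) (sym n≡p) (words-C (suc n) (suc p) 0 e) ⟩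
    suc p * (suc (suc n) * (suc n C suc p))       ∎
    where
      open ≡-Reasoning
      n≡p = trans (suc-injective e) (+-identityʳ p)
      lemma : ∀ p w → 2 * (suc p * w) + p * (suc p * w) ≡ suc p * (suc (suc p) * w)
      lemma = solve-∀
  codes-≥ (suc n) (suc p) (suc q) (suc d) refl refl = begin
    2 * ((q + suc d ∸ q) * words (suc p) (suc q) + (a + b))
      ≡⟨ cong₂ (λ k w → 2 * (k * w + (a + b))) (m+n∸m≡n q (suc d))
           (trans (words-C (suc n) (suc p) (suc q) refl) (pascal n p)) ⟩
    2 * (suc d * (x + y) + (a + b))               ≡⟨ distr (suc d * (x + y)) a b ⟩
    2 * (suc d * (x + y)) + (2 * a + 2 * b)
      ≡⟨ cong₂ (λ u v → 2 * (suc d * (x + y)) + (u + v))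
           (codes-≥ n p (suc q) d refl (+-suc q d))
           (codes-≥ n (suc p) q (suc (suc d)) (+-suc p q) (sym (+-suc q (suc d)))) ⟩
    2 * (suc d * (x + y)) + ((2 * S n (suc q) + d * (suc n * x)) + (2 * S n q + suc (suc d) * (suc n * y)))
      ≡⟨ +-cancelʳ-≡ (2 * (suc q * x)) _ _ (trans (ring d q x y (S n q) (S n (suc q)))
           (cong (λ u → 2 * (S n q + S n (suc q)) + suc d * (suc (suc n) * (x + y)) + 2 * u) absorb)) ⟩
    2 * (S n q + S n (suc q)) + suc d * (suc (suc n) * (x + y))
      ≡⟨ cong₂ (λ u v → 2 * u + suc d * (suc (suc n) * v)) (S-suc n q) (pascal n p) ⟨
    2 * S (suc n) (suc q) + suc d * (suc (suc n) * (suc n C suc p)) ∎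
    where
      open ≡-Reasoning
      a = codes p (suc q)
      b = codes (suc p) q
      x = n C p
      y = n C suc p
      absorb : suc p * y ≡ suc q * x
      absorb = +-cancelʳ-≡ (p * x) _ _ (trans (absorption n p) (lemma p q x))
        where
          lemma : ∀ p q x → (p + suc q) * x ≡ suc q * x + p * x
          lemma = solve-∀
      distr : ∀ u a b → 2 * (u + (a + b)) ≡ 2 * u + (2 * a + 2 * b)
      distr = solve-∀
      ring : ∀ d q x y s t →
        2 * (suc d * (x + y)) + ((2 * t + d * (suc (q + suc d + suc q) * x)) +
          (2 * s + suc (suc d) * (suc (q + suc d + suc q) * y))) + 2 * (suc q * x) ≡
        2 * (s + t) + suc d * (suc (suc (q + suc d + suc q)) * (x + y)) + 2 * (suc (q + suc d) * y)
      ring = solve-∀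

-- By symmetry the two partial sums make up the whole row 2N of Pascal's triangle.
L-middle : ∀ N → L (N + N) N + L (N + N) (suc N) ≡ 4 ^ N
L-middle zero    = refl
L-middle (suc zero) = refl
L-middle (suc N@(suc M)) = trans (cong (λ n → L n (suc N) + L n (suc (suc N))) (cong suc (+-suc N N))) (begin
  L (suc (suc n)) (suc N) + L (suc (suc n)) (suc (suc N))
    ≡⟨ cong₂ _+_ (trans (L-suc (suc n) N) (cong₂ _+_ (L-suc n M) (L-suc n N)))
                 (trans (L-suc (suc n) (suc N)) (cong₂ _+_ (L-suc n N) (L-suc n (suc N)))) ⟩
  ((L n M + L n N) + (L n N + L n (suc N))) + ((L n N + L n (suc N)) + (L n (suc N) + (L n (suc N) + n C suc N)))
    ≡⟨ cong (λ c → ((L n M + L n N) + (L n N + L n (suc N))) +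
         ((L n N + L n (suc N)) + (L n (suc N) + (L n (suc N) + c)))) mirror ⟩
  ((L n M + L n N) + (L n N + L n (suc N))) + ((L n N + L n (suc N)) + (L n (suc N) + (L n (suc N) + n C M)))
    ≡⟨ lemma (L n M) (n C M) (L n (suc N)) ⟩
  4 * (L n N + L n (suc N)) ≡⟨ cong (4 *_) (L-middle N) ⟩
  4 * 4 ^ N ∎)
  where
    open ≡-Reasoning
    n = N + N
    mirror : n C suc N ≡ n C M
    mirror = trans (nCk≡nC[n∸k] (s≤s (m≤n+m (suc M) M))) (cong (n C_) (m+n∸n≡m M (suc M)))
    lemma : ∀ l c u → ((l + (l + c)) + ((l + c) + u)) + (((l + c) + u) + (u + (u + c))) ≡ 4 * ((l + c) + u)
    lemma = solve-∀

-- Two uses of `S-suc` give four times the previous value plus a second difference of `S`, which is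
-- the sum in `L-middle`: the recurrence x(M+1) = 4 x(M) + 4^M.
S-middle : ∀ N → S (suc N + suc N) (suc N) ≡ suc N * 4 ^ N
S-middle zero    = refl
S-middle (suc N) = trans (cong (λ n → S n (suc M)) (cong suc (+-suc M M))) (begin
  S (suc (suc n)) (suc M) ≡⟨ trans (S-suc (suc n) M) (cong₂ _+_ (S-suc n N) (S-suc n M)) ⟩
  (S n N + S n M) + (S n M + S n (suc M)) ≡⟨ lemma (S n N) (D n M) (L n M) (L n (suc M)) ⟩
  4 * S n M + (L n M + L n (suc M)) ≡⟨ cong₂ (λ x y → 4 * x + y) (S-middle N) (L-middle M) ⟩
  4 * (M * 4 ^ N) + 4 * 4 ^ N ≡⟨ lemma₂ M (4 ^ N) ⟩
  suc M * (4 * 4 ^ N) ∎)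
  where
    open ≡-Reasoning
    M = suc N
    n = M + M
    lemma : ∀ s d l u → (s + (s + d)) + ((s + d) + ((s + d) + (d + (l + u)))) ≡ 4 * (s + d) + (l + u)
    lemma = solve-∀
    lemma₂ : ∀ m z → 4 * (m * z) + 4 * z ≡ suc m * (4 * z)
    lemma₂ = solve-∀

codes-diagonal : ∀ N → 1 ≤ N → codes N N ≡ N * 4 ^ (N ∸ 1)
codes-diagonal (suc N) _ = trans (codes-≤ _ (suc N) (suc N) refl ≤-refl) (S-middle N)

-- Words with a marked point

infixr 5 t∷_ f∷_

-- The length is a separate index, so positions in `Fin n` need no transport along n = p + q.
data Word : ℕ → ℕ → ℕ → Set where
  []  : Word 0 0 0
  t∷_ : ∀ {n p q} → Word n p q → Word (suc n) (suc p) q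
  f∷_ : ∀ {n p q} → Word n p q → Word (suc n) p (suc q)

letters : ∀ {n p q} → Word n p q → Fin n → Bool
letters (t∷ w) zero    = true
letters (t∷ w) (suc i) = letters w i
letters (f∷ w) zero    = false
letters (f∷ w) (suc i) = letters w i

letters-true : ∀ {n p q} (w : Word n p q) → cnt (letters w) ≡ p
letters-true []     = refl
letters-true (t∷ w) = cong suc (letters-true w)
letters-true (f∷ w) = letters-true w

letters-false : ∀ {n p q} (w : Word n p q) → cnt (not ∘ letters w) ≡ q
letters-false []     = refl
letters-false (t∷ w) = letters-false w
letters-false (f∷ w) = cong suc (letters-false w)

letters-injective : ∀ {n p q} {v w : Word n p q} → letters v ≗ letters w → v ≡ w
letters-injective {v = []}   {[]}   e = refl
letters-injective {v = t∷ v} {t∷ w} e = cong t∷_ (letters-injective (e ∘ suc))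
letters-injective {v = f∷ v} {f∷ w} e = cong f∷_ (letters-injective (e ∘ suc))
letters-injective {v = t∷ v} {f∷ w} e with e zero
... | ()
letters-injective {v = f∷ v} {t∷ w} e with e zero
... | ()

spell : ∀ {n p q} (P : Fin n → Bool) → cnt P ≡ p → cnt (not ∘ P) ≡ q →
  ∃ λ (w : Word n p q) → letters w ≗ P
spell {zero} P refl refl = [] , λ ()
spell {suc n} P ep eq with P zero in e
spell {suc n} {suc p} P ep eq | true with spell (P ∘ suc) (suc-injective ep) eq
... | w , ew = t∷ w , λ { zero → sym e ; (suc i) → ew i }
spell {suc n} {q = suc q} P ep eq | false with spell (P ∘ suc) ep (suc-injective eq)
... | w , ew = f∷ w , λ { zero → sym e ; (suc i) → ew i }

-- Trues minus falses among the letters from position m on, truncated at 0.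
excess : ∀ {n p q} → Word n p q → Fin n → ℕ
excess {p = p} {q} w zero    = p ∸ q
excess (t∷ w)        (suc m) = excess w m
excess (f∷ w)        (suc m) = excess w m

face-suc : ∀ {n} (m : ℕ) (i : Fin n) → face (suc m) (suc i) ≡ face m i
face-suc zero    i = refl
face-suc (suc m) i = refl

excess-height : ∀ {n p q} (w : Word n p q) m → height (face (toℕ m)) everywhere (letters w) ≡ excess w m
excess-height w zero = cong₂ _∸_ (letters-true w) (letters-false w)
excess-height (t∷ w) (suc m) = trans (cong₂ _∸_
  (cnt-cong λ i → cong (_∧ letters w i) (face-suc (toℕ m) i))
  (cnt-cong λ i → cong (_∧ not (letters w i)) (face-suc (toℕ m) i))) (excess-height w m)
excess-height (f∷ w) (suc m) = trans (cong₂ _∸_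
  (cnt-cong λ i → cong (_∧ letters w i) (face-suc (toℕ m) i))
  (cnt-cong λ i → cong (_∧ not (letters w i)) (face-suc (toℕ m) i))) (excess-height w m)

Code : ℕ → ℕ → ℕ → Set
Code n p q = Σ (Word n p q) λ w → Σ (Fin n) λ m → Fin (excess w m)

Tail : ℕ → ℕ → ℕ → Set
Tail n p q = Σ (Word (suc n) p q) λ w → Σ (Fin n) λ m → Fin (excess w (suc m))

code-split : ∀ {n p q} → Code (suc n) p q ↔ ((Fin (p ∸ q) × Word (suc n) p q) ⊎ Tail n p q)
code-split = mk↔ₛ′
  (λ { (w , zero , j) → inj₁ (j , w) ; (w , suc m , j) → inj₂ (w , m , j) })
  (λ { (inj₁ (j , w)) → w , zero , j ; (inj₂ (w , m , j)) → w , suc m , j })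
  (λ { (inj₁ _) → refl ; (inj₂ _) → refl })
  (λ { (w , zero , j) → refl ; (w , suc m , j) → refl })

words↔ : ∀ n p q → n ≡ p + q → Fin (words p q) ↔ Word n p q
words↔ zero zero zero e = mk↔ₛ′ (λ _ → []) (λ _ → zero) (λ { [] → refl }) (λ { zero → refl })
words↔ (suc n) zero (suc q) e = ↔-trans (words↔ n zero q (suc-injective e))
  (mk↔ₛ′ f∷_ (λ { (f∷ w) → w }) (λ { (f∷ w) → refl }) (λ _ → refl))
words↔ (suc n) (suc p) zero e = ↔-trans (words↔ n p zero (suc-injective e))
  (mk↔ₛ′ t∷_ (λ { (t∷ w) → w }) (λ { (t∷ w) → refl }) (λ _ → refl))
words↔ (suc n) (suc p) (suc q) e = ↔-trans +↔⊎ (↔-trans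
  (words↔ n p (suc q) (suc-injective e) ⊎-↔ words↔ n (suc p) q (trans (suc-injective e) (+-suc p q)))
  (mk↔ₛ′ (λ { (inj₁ w) → t∷ w ; (inj₂ w) → f∷ w }) (λ { (t∷ w) → inj₁ w ; (f∷ w) → inj₂ w })
    (λ { (t∷ w) → refl ; (f∷ w) → refl }) (λ { (inj₁ w) → refl ; (inj₂ w) → refl })))

codes↔ : ∀ n p q → n ≡ p + q → Fin (codes p q) ↔ Code n p q
codes↔ zero zero zero e = mk↔ₛ′ (λ ()) (λ { (_ , () , _) }) (λ { (_ , () , _) }) (λ ())
codes↔ (suc n) zero (suc q) e = ↔-trans (codes↔ n zero q (suc-injective e))
  -- The front position carries no index, since `0 ∸ suc q` is 0.
  (mk↔ₛ′ (λ { (w , m , j) → f∷ w , suc m , j }) (λ { (f∷ w , suc m , j) → w , m , j })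
    (λ { (f∷ w , suc m , j) → refl }) (λ _ → refl))
codes↔ (suc n) (suc p) zero e = ↔-trans +↔⊎ (↔-trans
  (↔-trans *↔× (↔-refl ×-↔ words↔ (suc n) (suc p) zero e) ⊎-↔ ↔-trans (codes↔ n p zero (suc-injective e))
    (mk↔ₛ′ (λ { (w , m , j) → t∷ w , m , j }) (λ { (t∷ w , m , j) → w , m , j })
      (λ { (t∷ w , m , j) → refl }) (λ _ → refl)))
  (↔-sym code-split))
codes↔ (suc n) (suc p) (suc q) e = ↔-trans +↔⊎ (↔-trans
  (↔-trans *↔× (↔-refl ×-↔ words↔ (suc n) (suc p) (suc q) e) ⊎-↔ ↔-trans +↔⊎ (↔-trans
    (codes↔ n p (suc q) (suc-injective e) ⊎-↔ codes↔ n (suc p) q (trans (suc-injective e) (+-suc p q)))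
    (mk↔ₛ′ (λ { (inj₁ (w , m , j)) → t∷ w , m , j ; (inj₂ (w , m , j)) → f∷ w , m , j })
      (λ { (t∷ w , m , j) → inj₁ (w , m , j) ; (f∷ w , m , j) → inj₂ (w , m , j) })
      (λ { (t∷ w , m , j) → refl ; (f∷ w , m , j) → refl }) (λ { (inj₁ _) → refl ; (inj₂ _) → refl }))))
  (↔-sym code-split))

-- From words to gluing data

open Solutions
open ConnGenus0Datum using (m₁; m₂; ι)


oriented-cong : ∀ {n f τ A ι ι' P Q} → ι ≗ ι' → P ≗ Q → Oriented {n} f τ A ι P → Oriented f τ A ι' Q
oriented-cong {f = f} {τ} {ι = ι} {ι'} {P} {Q} e e' O = record
  { gluing = record
    { faces    = faces G
    ; ι-invol  = λ i → trans (cong ι' (sym (e i))) (trans (sym (e _)) (ι-invol G i))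
    ; ι-fix    = λ p → trans (sym (e _)) (ι-fix G p)
    ; ι-act    = λ p q → ι-act G p (trans (e _) q)
    ; crossing = proj₁ (crossing G) , proj₁ (proj₂ (crossing G)) ,
        trans (cong f (sym (e _))) (proj₂ (proj₂ (crossing G)))
    }
  ; transversal = transversal-cong (λ i → cong τ (e i)) e' (transversal O)
  ; flip  = λ {i} p → trans (cong Q (sym (e i))) (trans (sym (e' _)) (trans (flip O p) (cong not (e' i))))
  ; cross = λ {i} p → trans (sym (e' i)) (cross O (trans (cong f (e i)) p))
  }
  where G = gluing O

datum-≡ : ∀ {N} {d d' : ConnGenus0Datum N} → m₁ d ≡ m₁ d' → m₂ d ≡ m₂ d' → ι d ≡ ι d' → d ≡ d'
datum-≡ {d = record { m₁ = _ ; m₂ = _ ; ι = _ }} {record { m₁ = _ ; m₂ = _ ; ι = _ }} refl refl refl = refl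

module _ (N' : ℕ) where

  private
    N n n' : ℕ
    N  = suc N'
    n  = 2 * N
    n' = N' + suc (N' + 0)

    n≡ : n ≡ N + N
    n≡ = cong (N +_) (+-identityʳ N)

  abstract
    solutions : (w : Word n N N) (m : Fin n') →
      Solutions (face (suc (toℕ m))) (τ (suc (toℕ m))) everywhere (letters w) (excess w (suc m))
    solutions w m = subst (Solutions _ _ _ _) (excess-height w (suc m))
      (enumerate _ (<-wellFounded _) (τ-faces (s≤s z≤n) (s≤s (toℕ<n m))) (λ ())
        (trans (letters-true w) (sym (trans (cnt-cong λ i → cong not (∧-identityʳ (letters w i))) (letters-false w)))))

  -- Position 0 would mean a first polygon without sides; the whole word has excess 0, so it rules
  -- itself out.
  no-code : ∀ {w : Word n N N} → Fin (excess w zero) → ⊥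
  no-code j with subst Fin (n∸n≡0 N) j
  ... | ()

  datum : (w : Word n N N) (m : Fin n') (ι : Fin n → Fin n) →
    Oriented (face (suc (toℕ m))) (τ (suc (toℕ m))) everywhere ι (letters w) → ConnGenus0Datum N
  datum w m ι O = record
    { m₁ = suc (toℕ m) ; m₂ = n ∸ suc (toℕ m)
    ; m₁-pos = s≤s z≤n ; m₂-pos = m<n⇒0<n∸m m<n ; m-sum = m+[n∸m]≡n (<⇒≤ m<n)
    ; ι = tabulate ι
    ; ι-invol = ι-invol (gluing O')
    ; ι-fpf = λ i → ι-act (gluing O') refl
    ; connected = gluing⇒transitive (s≤s z≤n) m<n (gluing O')
    ; genus0 = oriented⇒genus0 (s≤s z≤n) m<n n≡ O'
    }
    where
      m<n : suc (toℕ m) < n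
      m<n = s≤s (toℕ<n m)
      O' : Oriented (face (suc (toℕ m))) (τ (suc (toℕ m))) everywhere (lookup (tabulate ι)) (letters w)
      O' = oriented-cong (sym ∘ lookup∘tabulate ι) (λ _ → refl) O

  decode : Code n N N → ConnGenus0Datum N
  decode (w , zero  , j) = ⊥-elim (no-code {w} j)
  decode (w , suc m , j) = datum w m (sol (solutions w m) j) (good (solutions w m) j)

  -- The datum gives back the position through `m₁`, then the word by uniqueness of the orientation,
  -- then the index by distinctness of the solutions.
  decode-injective : ∀ {c d} → decode c ≡ decode d → c ≡ d
  decode-injective {w , zero , j} = ⊥-elim (no-code {w} j)
  decode-injective {w , suc m , j} {w' , zero , j'} = ⊥-elim (no-code {w'} j')
  decode-injective {w , suc m , j} {w' , suc m' , j'} e =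
    same-m (toℕ-injective (suc-injective (cong m₁ e))) j'
      λ i → trans (sym (lookup∘tabulate (sol (solutions w m) j) i))
        (trans (cong (λ d → lookup (ι d) i) e) (lookup∘tabulate (sol (solutions w' m') j') i))
    where
      same-w : w ≡ w' → ∀ j' → sol (solutions w m) j ≗ sol (solutions w' m) j' →
        _≡_ {A = Code n N N} (w , suc m , j) (w' , suc m , j')
      same-w refl j' e = cong (λ k → w , suc m , k) (distinct (solutions w m) e)

      same-m : m ≡ m' → ∀ j' → sol (solutions w m) j ≗ sol (solutions w' m') j' →
        _≡_ {A = Code n N N} (w , suc m , j) (w' , suc m' , j')
      same-m refl j' e = same-w (letters-injective (oriented-unique _ (oriented⇒reducible _ O')
          (oriented-cong e (λ _ → refl) (good (solutions w m) j)) O')) j' e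
        where O' = good (solutions w' m) j'

  decode-surjective : ∀ d → ∃ λ c → decode c ≡ d
  decode-surjective d@record
    { m₁ = k ; m₂ = l ; m₁-pos = k-pos ; m₂-pos = l-pos ; m-sum = k+l ; ι = v
    ; ι-invol = v-invol ; ι-fpf = v-fpf ; connected = conn ; genus0 = genus } = go k≡
    where
      sum : k + l ≡ n
      sum = recompute (_ ≟ⁿ _) k+l
      pos₁ : 1 ≤ k
      pos₁ = recompute (_ ≤? _) k-pos
      pos₂ : 1 ≤ l
      pos₂ = recompute (_ ≤? _) l-pos
      k<n : k < n
      k<n = ≤-trans (≤-reflexive (+-comm 1 k)) (≤-trans (+-monoʳ-≤ k pos₂) (≤-reflexive sum))

      predecessor : ∀ {h} → 1 ≤ h → h < suc n' → ∃ λ (m : Fin n') → h ≡ suc (toℕ m)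
      predecessor (s≤s _) (s≤s lt) = fromℕ< lt , cong suc (sym (toℕ-fromℕ< lt))

      k≡ = predecessor pos₁ k<n

      ι' : Fin n → Fin n
      ι' = lookup v
      inv : ∀ i → ι' (ι' i) ≡ i
      inv = recompute (all? λ i → ι' (ι' i) ≟ i) v-invol
      fpf : ∀ i → ι' i ≢ i
      fpf i e = ⊥-elim-irr (v-fpf i e)
      -- Transitivity is given only irrelevantly, but its consequence, a crossing edge, can be
      -- recovered by a finite search.
      cr : ∃ λ x → face k x ≡ false × face k (ι' x) ≡ true
      cr = recompute (any? λ x → face k x ≟ᵇ false ×-dec face k (ι' x) ≟ᵇ true)
        (transitive⇒crossing pos₁ k<n inv conn)
      R : Reducible (face k) (τ k) everywhere ι'
      R = genus0⇒reducible pos₁ k<n n≡ (gluing-everywhere pos₁ k<n inv fpf cr)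
        (recompute (_ ≟ⁿ _) genus)

      P : Fin n → Bool
      P = proj₁ (reducible⇒oriented _ R)
      O : Oriented (face k) (τ k) everywhere ι' P
      O = proj₂ (reducible⇒oriented _ R)
      P≡N : cnt P ≡ N
      P≡N = oriented-half pos₁ k<n n≡ O
      spelling : ∃ λ (w : Word n N N) → letters w ≗ P
      spelling = spell P P≡N (+-cancelˡ-≡ N _ _ (trans (cong (_+ cnt (not ∘ P)) (sym P≡N)) (trans (cnt-not P) n≡)))
      w : Word n N N
      w = proj₁ spelling

      go : (∃ λ (m : Fin n') → k ≡ suc (toℕ m)) → ∃ λ c → decode c ≡ d
      go (m , e) = (w , suc m , proj₁ found) , datum-≡ (sym e)
          (trans (cong (n ∸_) (sym e)) (trans (cong (_∸ k) (sym sum)) (m+n∸m≡n k l)))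
          (trans (tabulate-cong (proj₂ found)) (tabulate∘lookup v))
        where
          found : ∃ λ j → sol (solutions w m) j ≗ ι'
          found = complete (solutions w m) (subst (λ h → Oriented (face h) (τ h) everywhere ι' (letters w)) e
            (oriented-cong (λ _ → refl) (sym ∘ proj₂ spelling) O))

  code↔datum : Code n N N ↔ ConnGenus0Datum N
  code↔datum = mk↔ₛ′ decode (proj₁ ∘ decode-surjective) (proj₂ ∘ decode-surjective)
    λ c → decode-injective (proj₂ (decode-surjective (decode c)))

theorem2 : (N : ℕ) → 1 ≤ N → Fin (N * 4 ^ (N ∸ 1)) ↔ ConnGenus0Datum N
theorem2 (suc N) 1≤N = ↔-trans
  (subst (λ k → Fin k ↔ Code (2 * suc N) (suc N) (suc N)) (codes-diagonal (suc N) 1≤N)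
    (codes↔ (2 * suc N) (suc N) (suc N) (cong (suc N +_) (+-identityʳ (suc N)))))
  (code↔datum N)
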